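{- Let $G$ be a finite connected graph with vertices $v_1,\dots,v_n$, let $w:D(G)\to\mathbb{C}$ be a symmetric weight function with $\kappa_w(G)\neq 0$, and let ${\bf W}$ be the weighted matrix of $G$ corresponding to $w$. Let \[ f_w(u,t)=\det\big({\bf I}_n-t{\bf W}+(1-u)t^2({\bf D}_w-(1-u){\bf I}_n)\big). \] Then for every nonzero complex number $t$, \[ \frac{\partial^2 f_w(u,t)}{\partial t^2}\Big|_{(1-1/t,t)}=2t^{n-4}\kappa_w(G)\big(Kf^z_w(t)+nt(2w(G)t-2n+1)\big), \] \[ \frac{\partial^2 f_w(u,t)}{\partial t\,\partial u}\Big|_{(1-1/t,t)}=2t^{n-2}\kappa_w(G)\big((n-w(G)t)(n+1)t-Kf^z_w(t)\big), \] \[ \frac{\partial^2 f_w(u,t)}{\partial u^2}\Big|_{(1-1/t,t)}=2t^{n}\kappa_w(G)\big(Kf^z_w(t)-nt\big). \]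
   Context: $D(G)=\{(u,v),(v,u): uv\in E(G)\}$ is the set of arcs of the symmetric digraph of $G$; for an arc $e=(u,v)$, $o(e)=u$, $e^{ -1}=(v,u)$. A weight function $w:D(G)\to\mathbb{C}$ is symmetric if $w(e^{ -1})=w(e)$ for all $e$. The weighted matrix ${\bf W}=(w_{ij})$ is the $n\times n$ matrix with $w_{ij}=w(v_i,v_j)$ if $(v_i,v_j)\in D(G)$ and $0$ otherwise. ${\bf D}_w$ is diagonal with entries $d^w_i=\sum_{o(e)=v_i}w(e)$, and ${\bf L}={\bf D}_w-{\bf W}$ is the weighted Laplacian. $w(G)=\sum_{uv\in E(G)}w(u,v)$. The weighted complexity is $\kappa_w(G)=\sum_T\prod_{e\in E(T)}w(e)$ over spanning trees $T$. For $p\neq q$, $r_{pq}=\det({\bf L}^{(pq)})/\kappa_w(G)$, where ${\bf L}^{(pq)}$ is obtained from ${\bf L}$ by deleting rows and columns $p$ and $q$. The weighted Kirchhoff index function is $Kf^z_w(t)=\sum_{1\le p<q\le n}(d^w_pt-2)(d^w_qt-2)r_{pq}$. The notation $|_{(1-1/t,t)}$ means evaluation at $u=1-1/t$ with the same $t$. -}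

module Defs where

open import Level using (Level; _⊔_)
open import Function using (_∘_; id)
open import Algebra.Bundles using (CommutativeRing)
open import Algebra.Bundles.Raw using (RawRing)
open import Data.Nat as ℕ using (ℕ; zero; suc; _∸_; _≡ᵇ_; _<ᵇ_)
open import Data.Fin using (Fin; zero; suc; toℕ; punchIn; punchOut)
open import Data.Fin.Properties using (_≟_)
open import Data.Bool using (T?; Bool; true; false; if_then_else_; _∧_; _∨_)
open import Data.List using (List; []; _∷_; _++_; map; foldr; length; filter; allFin; concatMap)
open import Data.Bool.ListAction using (all; any)
open import Data.Product using (_×_; _,_)
open import Relation.Nullary using (¬_; yes; no)
open import Relation.Binary.PropositionalEquality using (_≡_; _≢_)

module RingOps {c ℓ} (R : RawRing c ℓ) where
  open RawRing R

  sumF : (n : ℕ) → (Fin n → Carrier) → Carrier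
  sumF zero    f = 0#
  sumF (suc n) f = f zero + sumF n (f ∘ suc)

  sumL : List Carrier → Carrier
  sumL = foldr _+_ 0#

  prodL : List Carrier → Carrier
  prodL = foldr _*_ 1#

  sign : ℕ → Carrier
  sign zero    = 1#
  sign (suc k) = - sign k

  fromℕ : ℕ → Carrier
  fromℕ zero    = 0#
  fromℕ (suc k) = 1# + fromℕ k

  _^_ : Carrier → ℕ → Carrier
  x ^ zero  = 1#
  x ^ suc k = x * (x ^ k)

  det : ∀ {n} → (Fin n → Fin n → Carrier) → Carrier
  det {zero}  M = 1#
  det {suc n} M =
    sumF (suc n) λ j → sign (toℕ j) * (M zero j * det (λ a b → M (suc a) (punchIn j b)))

  delete2 : ∀ {m} → (Fin (suc (suc m)) → Fin (suc (suc m)) → Carrier) →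
            (p q : Fin (suc (suc m))) → p ≢ q → Fin m → Fin m → Carrier
  delete2 M p q p≢q a b =
    M (punchIn p (punchIn (punchOut p≢q) a)) (punchIn p (punchIn (punchOut p≢q) b))

  -- det of the matrix with rows and columns p and q deleted (0 if p = q, never used)
  detDel2 : ∀ {n} → (Fin n → Fin n → Carrier) → Fin n → Fin n → Carrier
  detDel2 {zero}        M p q = 0#
  detDel2 {suc zero}    M p q = 0#
  detDel2 {suc (suc m)} M p q with p ≟ q
  ... | yes _   = 0#
  ... | no p≢q  = det (delete2 M p q p≢q)

-- Univariate polynomials (coefficient lists, constant term first)
-- over a raw ring, with formal derivative and evaluation.

module PolyOps {c ℓ} (R : RawRing c ℓ) where
  open RawRing R
  open RingOps R using (fromℕ)

  Poly : Set c
  Poly = List Carrier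

  addP : Poly → Poly → Poly
  addP []       q        = q
  addP (a ∷ p)  []       = a ∷ p
  addP (a ∷ p)  (b ∷ q)  = (a + b) ∷ addP p q

  mulP : Poly → Poly → Poly
  mulP []      q = []
  mulP (a ∷ p) q = addP (map (a *_) q) (0# ∷ mulP p q)

  negP : Poly → Poly
  negP = map -_

  constP : Carrier → Poly
  constP a = a ∷ []

  varP : Poly
  varP = 0# ∷ 1# ∷ []

  polyRing : RawRing c c
  polyRing = record
    { Carrier = Poly ; _≈_ = _≡_ ; _+_ = addP ; _*_ = mulP ; -_ = negP
    ; 0# = [] ; 1# = 1# ∷ [] }

  derivFrom : ℕ → Poly → Poly
  derivFrom k []      = []
  derivFrom k (b ∷ q) = (fromℕ k * b) ∷ derivFrom (suc k) q

  deriv : Poly → Poly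
  deriv []      = []
  deriv (a ∷ p) = derivFrom 1 p

  eval : Carrier → Poly → Carrier
  eval x = foldr (λ a acc → a + x * acc) 0#

record FieldStr {c ℓ} (R : CommutativeRing c ℓ) : Set (c ⊔ ℓ) where
  open CommutativeRing R
  field
    1≉0   : ¬ (1# ≈ 0#)
    inv   : (x : Carrier) → ¬ (x ≈ 0#) → Carrier
    inv-r : (x : Carrier) (x≉0 : ¬ (x ≈ 0#)) → x * inv x x≉0 ≈ 1#

data Walk {n : ℕ} (adj : Fin n → Fin n → Bool) : Fin n → Fin n → Set where
  here  : ∀ {i} → Walk adj i i
  there : ∀ {i j k} → adj i j ≡ true → Walk adj j k → Walk adj i k

Connected : ∀ {n} → (Fin n → Fin n → Bool) → Set
Connected {n} adj = ∀ (i j : Fin n) → Walk adj i j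

-- Weighted graph data: simple graph G on vertices Fin n (adjacency adj),
-- weight w on arcs (only values w i j with adj i j ≡ true matter).

module Weighted {c ℓ} (R : CommutativeRing c ℓ) {n : ℕ}
                (adj : Fin n → Fin n → Bool) (w : Fin n → Fin n → CommutativeRing.Carrier R) where
  open CommutativeRing R
  open RingOps rawRing public

  eqF : Fin n → Fin n → Bool
  eqF i j = toℕ i ≡ᵇ toℕ j

  δ : Fin n → Fin n → Carrier
  δ i j = if eqF i j then 1# else 0#

  Wm : Fin n → Fin n → Carrier
  Wm i j = if adj i j then w i j else 0#

  dw : Fin n → Carrier
  dw i = sumF n (λ j → Wm i j)

  Lap : Fin n → Fin n → Carrier
  Lap i j = (if eqF i j then dw i else 0#) - Wm i j

  edges : List (Fin n × Fin n)
  edges = concatMap (λ i → map (λ j → (i , j))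
                       (filter (λ j → T? (adj i j ∧ (toℕ i <ᵇ toℕ j))) (allFin n)))
                    (allFin n)

  wG : Carrier
  wG = sumL (map (λ { (i , j) → w i j }) edges)

  sublists : ∀ {a} {A : Set a} → List A → List (List A)
  sublists []       = [] ∷ []
  sublists (x ∷ xs) = sublists xs ++ map (x ∷_) (sublists xs)

  reach : List (Fin n × Fin n) → Fin n → ℕ → Fin n → Bool
  reach S s zero    v = eqF v s
  reach S s (suc k) v = reach S s k v ∨
    any (λ { (a , b) → (eqF a v ∧ reach S s k b) ∨ (eqF b v ∧ reach S s k a) }) S

  connectedB : List (Fin n × Fin n) → Bool
  connectedB S = all (λ s → all (reach S s n) (allFin n)) (allFin n)

  isSpanningTree : List (Fin n × Fin n) → Bool
  isSpanningTree S = (length S ≡ᵇ (n ∸ 1)) ∧ connectedB S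

  κw : Carrier
  κw = sumL (map (λ S → prodL (map (λ { (i , j) → w i j }) S))
                 (filter (λ S → T? (isSpanningTree S)) (sublists edges)))

  two : Carrier
  two = 1# + 1#

  -- weighted Kirchhoff index function Kf^z_w(t), with r_pq = det(L^(pq)) / κ_w(G)
  Kfz : (κinv : Carrier) → Carrier → Carrier
  Kfz κinv t = sumF n λ p → sumF n λ q →
    if toℕ p <ᵇ toℕ q
    then ((dw p * t - two) * (dw q * t - two)) * (detDel2 Lap p q * κinv)
    else 0#

  -- bivariate polynomials: polynomials in t whose coefficients are polynomials in u
  module PU = PolyOps rawRing
  module PTU = PolyOps PU.polyRing
  module DetTU = RingOps PTU.polyRing

  BiPoly : Set c
  BiPoly = PTU.Poly

  private
    _⊕_ = PTU.addP
    _⊗_ = PTU.mulP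
    ⊖_  = PTU.negP
    cst : Carrier → BiPoly
    cst a = PTU.constP (PU.constP a)
    U T 1-U : BiPoly
    U   = PTU.constP PU.varP
    T   = PTU.varP
    1-U = cst 1# ⊕ (⊖ U)

  fMat : Fin n → Fin n → BiPoly
  fMat i j = (cst (δ i j) ⊕ (⊖ (T ⊗ cst (Wm i j))))
           ⊕ ((1-U ⊗ (T ⊗ T)) ⊗ (cst (δ i j * dw i) ⊕ (⊖ (1-U ⊗ cst (δ i j)))))

  fw : BiPoly
  fw = DetTU.det fMat

  ∂t : BiPoly → BiPoly
  ∂t = PTU.deriv

  ∂u : BiPoly → BiPoly
  ∂u = map PU.deriv

  evalAt : Carrier → Carrier → BiPoly → Carrier
  evalAt u t F = PU.eval t (map (PU.eval u) F)

{-# OPTIONS --safe #-}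

-- Put y = 1 − (1−u)t. Then I − tW + (1−u)t²(D − (1−u)I) = tL + diag(y g_p) with g_p = 2 − y − t d_p, so
-- modulo y³ the function f_w(u,t) is
--   det(tL) + y Σ_p g_p det(tL)^(p) + y² Σ_{p<q} g_p g_q det(tL)^(pq).
-- Here det L = 0, every principal minor L^(p) has determinant κ_w by the matrix-tree theorem, and
-- Σ_p d_p = 2 w(G). As y vanishes at u = 1 − 1/t, the second derivatives there are read off from this
-- expansion; they are computed as the ε₁ε₂-coefficient over the ring R[ε₁,ε₂]/(ε₁²,ε₂²).
--
-- The matrix-tree theorem is proved for rooted forests: det L with the rows in a vertex set X replaced by
-- unit vectors counts the edge sets of size n − |X| joining every vertex to X. Removing an edge ab with
-- a ∈ X and b ∉ X splits both sides into the terms for X and for X ∪ {b}; if no edge leaves X, the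
-- indicator of the complement of X is in the left kernel.

module Submission where

open import Defs
open import Algebra.Bundles using (AbelianGroup; CommutativeRing)
open import Algebra.Bundles.Raw using (RawRing)
import Algebra.Construct.DirectProduct as DirectProduct
import Algebra.Properties.Ring
import Algebra.Properties.Semiring.Mult.TCOptimised
import Algebra.Solver.Ring
open import Algebra.Solver.Ring.AlmostCommutativeRing using (fromCommutativeRing; _-Raw-AlmostCommutative⟶_)
open import Algebra.Structures using (IsCommutativeRing)
open import Data.Bool using (Bool; true; false; if_then_else_; _∧_; _∨_; T; T?)
open import Data.Bool.ListAction using (all; any; or)
import Data.Bool.Properties as Boolₚ
open import Data.Bool.Properties using (T-≡; T-∧; T-∨)
open import Data.Empty using (⊥-elim)
open import Data.Fin using (Fin; zero; suc; toℕ; punchIn; punchOut)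
import Data.Fin.Properties as Finₚ
open import Data.Fin.Properties using (_≟_; punchInᵢ≢i; punchIn-injective; punchIn-punchOut; suc-injective; toℕ-injective)
open import Data.Integer as ℤ using (ℤ; -[1+_]; _⊖_)
import Data.Integer.Properties as ℤₚ
open import Data.List using (List; []; _∷_; _++_; map; length; filter; tabulate; allFin; concatMap)
open import Data.List.Membership.Propositional using (_∈_; find; lose)
open import Data.List.Membership.Propositional.Properties using (∈-allFin)
import Data.List.Properties as Listₚ
open import Data.List.Relation.Binary.Permutation.Propositional as ↭ using (_↭_; prep; swap; ↭-refl; ↭-sym; ↭-trans)
open import Data.List.Relation.Binary.Permutation.Propositional.Properties using (∈-resp-↭; ↭-length)
open import Data.List.Relation.Unary.All as All using (All; []; _∷_)
import Data.List.Relation.Unary.All.Properties as Allₚ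
open import Data.List.Relation.Unary.Any using (here; there)
import Data.List.Relation.Unary.Any.Properties as Anyₚ
open import Data.Maybe using (Maybe; just; nothing)
open import Data.Nat as ℕ using (ℕ; zero; suc; _≡ᵇ_; _<ᵇ_; _≤_; _<_; z≤n; s≤s)
import Data.Nat.Properties as ℕₚ
open import Data.Product using (_×_; _,_; proj₁; proj₂; ∃)
open import Data.Sum using (_⊎_; inj₁; inj₂)
open import Function using (_∘_; id; case_of_)
open import Function.Bundles using (Equivalence; mk⇔)
open import Level using (_⊔_)
import Relation.Binary.Reasoning.Setoid
open import Relation.Binary.PropositionalEquality as ≡ using (_≡_; _≢_)
open import Relation.Nullary using (¬_; Dec; yes; no; does)
open import Relation.Nullary.Decidable using (dec-true; dec-false; decidable-stable; _×-dec_; ¬?)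

open Equivalence using (to; from)

-- Two nilpotents are used because with a single ε the coefficient of ε² would be half the second
-- derivative, and 2 need not be invertible. One formula, bilinear in two directions, then yields
-- all three derivatives. Coefficient lists obey the ring laws only up to trailing zeros, so
-- determinant theory is never applied to them: `fw` is first evaluated into a genuine commutative
-- ring, and evaluation commutes with the recursion that defines the determinant. Deleting rows and
-- columns would change the size of the matrix and bring in exponents such as n - 2. A row turned
-- into a unit vector has the same effect on the determinant at fixed size, so row sets can grow one
-- element at a time, both in the expansion in y and in the forest count. Division is confined to
-- two elements with t · ti = 1 and κ · κi = 1; the final formulas are therefore polynomial
-- identities modulo t · ti - 1.

-- A ring solver with integer coefficients

module IntegerSolver {c ℓ} (R : CommutativeRing c ℓ) where
  open CommutativeRing R
  open Algebra.Properties.Ring ring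
  open Algebra.Properties.Semiring.Mult.TCOptimised semiring using (×-homo-+; ×1-homo-*; 1+×) renaming (_×_ to _·_)
  open Relation.Binary.Reasoning.Setoid setoid

  ⟦_⟧ℤ : ℤ → Carrier
  ⟦ ℤ.+ n ⟧ℤ    = n · 1#
  ⟦ -[1+ n ] ⟧ℤ = - (suc n · 1#)

  ⊖-homo : ∀ m n → ⟦ m ⊖ n ⟧ℤ ≈ m · 1# - n · 1#
  ⊖-homo m zero = begin
    m · 1#      ≈⟨ +-identityʳ _ ⟨
    m · 1# + 0# ≈⟨ +-congˡ -0#≈0# ⟨
    m · 1# - 0# ∎
  ⊖-homo zero    (suc n) = sym (+-identityˡ _)
  ⊖-homo (suc m) (suc n) = begin
    ⟦ suc m ⊖ suc n ⟧ℤ                        ≡⟨ ≡.cong ⟦_⟧ℤ (ℤₚ.[1+m]⊖[1+n]≡m⊖n m n) ⟩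
    ⟦ m ⊖ n ⟧ℤ                                ≈⟨ ⊖-homo m n ⟩
    m · 1# - n · 1#                           ≈⟨ +-congʳ (+-identityˡ _) ⟨
    0# + m · 1# - n · 1#                      ≈⟨ +-congʳ (+-congʳ (-‿inverseʳ 1#)) ⟨
    1# - 1# + m · 1# - n · 1#                 ≈⟨ +-congʳ (trans (+-assoc _ _ _) (trans (+-congˡ (+-comm _ _)) (sym (+-assoc _ _ _)))) ⟩
    1# + m · 1# - 1# - n · 1#                 ≈⟨ trans (+-assoc _ _ _) (+-congˡ (-‿+-comm 1# (n · 1#))) ⟩
    1# + m · 1# - (1# + n · 1#)               ≈⟨ +-cong (1+× m 1#) (-‿cong (1+× n 1#)) ⟨
    suc m · 1# - suc n · 1#                   ∎

  neg-homo : ∀ i → ⟦ ℤ.- i ⟧ℤ ≈ - ⟦ i ⟧ℤ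
  neg-homo (ℤ.+ zero)  = sym -0#≈0#
  neg-homo (ℤ.+ suc n) = refl
  neg-homo -[1+ n ]    = sym (-‿involutive _)

  +-homo : ∀ i j → ⟦ i ℤ.+ j ⟧ℤ ≈ ⟦ i ⟧ℤ + ⟦ j ⟧ℤ
  +-homo (ℤ.+ m)  (ℤ.+ n)  = ×-homo-+ 1# m n
  +-homo (ℤ.+ m)  -[1+ n ] = ⊖-homo m (suc n)
  +-homo -[1+ m ] (ℤ.+ n)  = trans (⊖-homo n (suc m)) (+-comm _ _)
  +-homo -[1+ m ] -[1+ n ] = begin
    - (suc (suc (m ℕ.+ n)) · 1#)         ≡⟨ ≡.cong (λ k → - (k · 1#)) (≡.cong suc (≡.sym (ℕₚ.+-suc m n))) ⟩
    - ((suc m ℕ.+ suc n) · 1#)           ≈⟨ -‿cong (×-homo-+ 1# (suc m) (suc n)) ⟩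
    - (suc m · 1# + suc n · 1#)          ≈⟨ -‿+-comm _ _ ⟨
    - (suc m · 1#) + - (suc n · 1#)      ∎

  *-homo⁺ : ∀ m j → ⟦ ℤ.+ m ℤ.* j ⟧ℤ ≈ ⟦ ℤ.+ m ⟧ℤ * ⟦ j ⟧ℤ
  *-homo⁺ m (ℤ.+ n)  = trans (reflexive (≡.cong ⟦_⟧ℤ (≡.sym (ℤₚ.pos-* m n)))) (×1-homo-* m n)
  *-homo⁺ m -[1+ n ] = begin
    ⟦ ℤ.+ m ℤ.* -[1+ n ] ⟧ℤ          ≡⟨ ≡.cong ⟦_⟧ℤ (ℤₚ.neg-distribʳ-* (ℤ.+ m) (ℤ.+ suc n)) ⟨
    ⟦ ℤ.- (ℤ.+ m ℤ.* ℤ.+ suc n) ⟧ℤ   ≈⟨ neg-homo (ℤ.+ m ℤ.* ℤ.+ suc n) ⟩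
    - ⟦ ℤ.+ m ℤ.* ℤ.+ suc n ⟧ℤ       ≈⟨ -‿cong (*-homo⁺ m (ℤ.+ suc n)) ⟩
    - (⟦ ℤ.+ m ⟧ℤ * (suc n · 1#))    ≈⟨ -‿distribʳ-* _ _ ⟩
    ⟦ ℤ.+ m ⟧ℤ * - (suc n · 1#)      ∎

  *-homo : ∀ i j → ⟦ i ℤ.* j ⟧ℤ ≈ ⟦ i ⟧ℤ * ⟦ j ⟧ℤ
  *-homo (ℤ.+ m)  j = *-homo⁺ m j
  *-homo -[1+ m ] j = begin
    ⟦ -[1+ m ] ℤ.* j ⟧ℤ              ≡⟨ ≡.cong ⟦_⟧ℤ (ℤₚ.neg-distribˡ-* (ℤ.+ suc m) j) ⟨
    ⟦ ℤ.- (ℤ.+ suc m ℤ.* j) ⟧ℤ       ≈⟨ neg-homo (ℤ.+ suc m ℤ.* j) ⟩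
    - ⟦ ℤ.+ suc m ℤ.* j ⟧ℤ           ≈⟨ -‿cong (*-homo⁺ (suc m) j) ⟩
    - ((suc m · 1#) * ⟦ j ⟧ℤ)        ≈⟨ -‿distribˡ-* _ _ ⟩
    - (suc m · 1#) * ⟦ j ⟧ℤ          ∎

  morphism : ℤ.+-*-rawRing -Raw-AlmostCommutative⟶ fromCommutativeRing R
  morphism = record
    { ⟦_⟧ = ⟦_⟧ℤ ; +-homo = +-homo ; *-homo = *-homo ; -‿homo = neg-homo
    ; 0-homo = refl ; 1-homo = refl }

  -- Equality in `R` need not be decidable. Normal forms therefore carry integer coefficients, which
  -- can be compared, so numerals cancel in any commutative ring.
  coefficient-≟ : ∀ i j → Maybe (⟦ i ⟧ℤ ≈ ⟦ j ⟧ℤ)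
  coefficient-≟ i j with i ℤₚ.≟ j
  ... | yes i≡j = just (reflexive (≡.cong ⟦_⟧ℤ i≡j))
  ... | no  _   = nothing

  open Algebra.Solver.Ring ℤ.+-*-rawRing (fromCommutativeRing R) morphism coefficient-≟ public

-- Finite sums and pairs of distinct indices

-- (punchIn j k , punchBack j k) names the ordered pair of distinct indices (j , punchIn j k) in reverse order.
punchBack : ∀ {m} → Fin (suc m) → Fin m → Fin m
punchBack {suc m} zero    k       = zero
punchBack {suc m} (suc j) zero    = j
punchBack {suc m} (suc j) (suc k) = suc (punchBack j k)

punchIn-punchBack : ∀ {m} (j : Fin (suc m)) k → punchIn (punchIn j k) (punchBack j k) ≡ j
punchIn-punchBack {suc m} zero    k       = ≡.refl
punchIn-punchBack {suc m} (suc j) zero    = ≡.refl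
punchIn-punchBack {suc m} (suc j) (suc k) = ≡.cong suc (punchIn-punchBack j k)

-- The indices that survive two deletions do not depend on the order of the deletions. This
-- identifies the double minors of a pair of columns and of the reversed pair.
punchIn-comm : ∀ {m} (j : Fin (suc (suc m))) k b →
  punchIn (punchIn j k) (punchIn (punchBack j k) b) ≡ punchIn j (punchIn k b)
punchIn-comm {m}     zero    k       b       = ≡.refl
punchIn-comm {m}     (suc j) zero    b       = ≡.refl
punchIn-comm {suc m} (suc j) (suc k) zero    = ≡.refl
punchIn-comm {suc m} (suc j) (suc k) (suc b) = ≡.cong suc (punchIn-comm j k b)

⁅_⁆ : ∀ {n} → Fin n → Fin n → Bool
⁅ p ⁆ i = does (i ≟ p)

module Sums {c ℓ} (R : CommutativeRing c ℓ) where
  open CommutativeRing R hiding (zero)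
  open RingOps rawRing
  open Relation.Binary.Reasoning.Setoid setoid
  open IntegerSolver R using (solve; _:=_; _:+_)

  opaque
    -- sumF behind an opaque name: sumF (suc n) f unfolds, after which f can no longer be inferred.
    ∑ : ∀ {n} → (Fin n → Carrier) → Carrier
    ∑ {n} = sumF n

    ∑≡sumF : ∀ {n} (f : Fin n → Carrier) → ∑ f ≡ sumF n f
    ∑≡sumF f = ≡.refl

    ∑-nil : ∀ {f : Fin 0 → Carrier} → ∑ f ≡ 0#
    ∑-nil = ≡.refl

    ∑-cons : ∀ {n} (f : Fin (suc n) → Carrier) → ∑ f ≡ f zero + ∑ (f ∘ suc)
    ∑-cons f = ≡.refl

    ∑-cong : ∀ {n} {f g : Fin n → Carrier} → (∀ i → f i ≈ g i) → ∑ f ≈ ∑ g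
    ∑-cong {zero}  eq = refl
    ∑-cong {suc n} eq = +-cong (eq zero) (∑-cong (eq ∘ suc))

    ∑-zero : ∀ {n} {f : Fin n → Carrier} → (∀ i → f i ≈ 0#) → ∑ f ≈ 0#
    ∑-zero {zero}  eq = refl
    ∑-zero {suc n} eq = trans (+-cong (eq zero) (∑-zero (eq ∘ suc))) (+-identityˡ 0#)

    ∑-+ : ∀ {n} (f g : Fin n → Carrier) → ∑ (λ i → f i + g i) ≈ ∑ f + ∑ g
    ∑-+ {zero}  f g = sym (+-identityˡ 0#)
    ∑-+ {suc n} f g = trans (+-congˡ (∑-+ (f ∘ suc) (g ∘ suc)))
      (solve 4 (λ a b s t → (a :+ b) :+ (s :+ t) := (a :+ s) :+ (b :+ t)) refl _ _ _ _)

    ∑-*ˡ : ∀ {n} x (f : Fin n → Carrier) → ∑ (λ i → x * f i) ≈ x * ∑ f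
    ∑-*ˡ {zero}  x f = sym (zeroʳ x)
    ∑-*ˡ {suc n} x f = trans (+-congˡ (∑-*ˡ x (f ∘ suc))) (sym (distribˡ x _ _))

    ∑-const : ∀ n x → ∑ {n} (λ _ → x) ≈ fromℕ n * x
    ∑-const zero    x = sym (zeroˡ x)
    ∑-const (suc n) x = trans (+-congˡ (∑-const n x))
      (sym (trans (distribʳ x 1# (fromℕ n)) (+-congʳ (*-identityˡ x))))

  ∑-swap : ∀ {m n} (f : Fin m → Fin n → Carrier) → ∑ (λ i → ∑ (f i)) ≈ ∑ (λ j → ∑ (λ i → f i j))
  ∑-swap {zero}  f = trans (reflexive ∑-nil) (sym (∑-zero λ j → reflexive ∑-nil))
  ∑-swap {suc m} f = begin
    ∑ (λ i → ∑ (f i))                          ≡⟨ ∑-cons _ ⟩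
    ∑ (f zero) + ∑ (λ i → ∑ (f (suc i)))       ≈⟨ +-congˡ (∑-swap (f ∘ suc)) ⟩
    ∑ (f zero) + ∑ (λ j → ∑ (λ i → f (suc i) j)) ≈⟨ ∑-+ (f zero) _ ⟨
    ∑ (λ j → f zero j + ∑ (λ i → f (suc i) j)) ≈⟨ ∑-cong (λ j → reflexive (∑-cons _)) ⟨
    ∑ (λ j → ∑ (λ i → f i j))                  ∎

  ∑-single : ∀ {n} (p : Fin n) (f : Fin n → Carrier) → (∀ i → i ≢ p → f i ≈ 0#) → ∑ f ≈ f p
  ∑-single zero    f off = trans (reflexive (∑-cons f))
    (trans (+-congˡ (∑-zero (λ i → off (suc i) λ ()))) (+-identityʳ _))
  ∑-single (suc p) f off = trans (reflexive (∑-cons f))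
    (trans
      (+-cong (off zero λ ()) (∑-single p (f ∘ suc) (λ i i≢p → off (suc i) (i≢p ∘ suc-injective))))
      (+-identityˡ _))

  -- The ordered pairs of distinct indices fall into those with first entry 0, those with second
  -- entry 0, and the rest. Reversal exchanges the first two families and preserves the third, which
  -- gives the induction for both lemmas below.
  ∑∑-cons : ∀ {m} (h : Fin (suc (suc m)) → Fin (suc m) → Carrier) →
    ∑ (λ j → ∑ (h j)) ≈ ∑ (h zero) + (∑ (λ j → h (suc j) zero) + ∑ (λ j → ∑ (λ k → h (suc j) (suc k))))
  ∑∑-cons h = trans (reflexive (∑-cons _)) (+-congˡ (trans (∑-cong (λ j → reflexive (∑-cons _))) (∑-+ _ _)))

  ∑-swap-distinct : ∀ {m} (h : Fin (suc m) → Fin m → Carrier) →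
    ∑ (λ j → ∑ (h j)) ≈ ∑ (λ j → ∑ (λ k → h (punchIn j k) (punchBack j k)))
  ∑-swap-distinct {zero}  h = ∑-cong (λ j → reflexive (≡.trans ∑-nil (≡.sym ∑-nil)))
  ∑-swap-distinct {suc m} h = begin
    ∑ (λ j → ∑ (h j))
      ≈⟨ ∑∑-cons h ⟩
    s₁ + (s₂ + ∑ (λ j → ∑ (λ k → h (suc j) (suc k))))
      ≈⟨ +-congˡ (+-congˡ (∑-swap-distinct (λ j k → h (suc j) (suc k)))) ⟩
    s₁ + (s₂ + s₃)
      ≈⟨ solve 3 (λ a b d → a :+ (b :+ d) := b :+ (a :+ d)) refl s₁ s₂ s₃ ⟩
    s₂ + (s₁ + s₃)
      ≈⟨ ∑∑-cons (λ j k → h (punchIn j k) (punchBack j k)) ⟨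
    ∑ (λ j → ∑ (λ k → h (punchIn j k) (punchBack j k))) ∎
    where
    s₁ = ∑ (h zero)
    s₂ = ∑ (λ j → h (suc j) zero)
    s₃ = ∑ (λ j → ∑ (λ k → h (suc (punchIn j k)) (suc (punchBack j k))))

  -- Pairing off each index pair with its reversal keeps this valid in characteristic 2.
  ∑-antisymmetric : ∀ {m} (h : Fin (suc m) → Fin m → Carrier) →
    (∀ j k → h (punchIn j k) (punchBack j k) ≈ - h j k) → ∑ (λ j → ∑ (h j)) ≈ 0#
  ∑-antisymmetric {zero}  h anti = ∑-zero (λ j → reflexive ∑-nil)
  ∑-antisymmetric {suc m} h anti = begin
    ∑ (λ j → ∑ (h j))
      ≈⟨ ∑∑-cons h ⟩
    s₁ + (s₂ + ∑ (λ j → ∑ (λ k → h (suc j) (suc k))))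
      ≈⟨ +-congˡ (+-congˡ (∑-antisymmetric (λ j k → h (suc j) (suc k)) (λ j k → anti (suc j) (suc k)))) ⟩
    s₁ + (s₂ + 0#)                     ≈⟨ +-congˡ (+-identityʳ s₂) ⟩
    s₁ + s₂                            ≈⟨ ∑-+ (h zero) _ ⟨
    ∑ (λ j → h zero j + h (suc j) zero) ≈⟨ ∑-zero (λ j → trans (+-congˡ (anti zero j)) (-‿inverseʳ _)) ⟩
    0# ∎
    where
    s₁ = ∑ (h zero)
    s₂ = ∑ (λ j → h (suc j) zero)

-- Determinants: expansion along any row, alternation, linearity in a row

module Determinants {c ℓ} (R : CommutativeRing c ℓ) where
  open CommutativeRing R hiding (zero)
  open RingOps rawRing hiding (det)
  private module Ops = RingOps rawRing
  open Relation.Binary.Reasoning.Setoid setoid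
  open IntegerSolver R using (solve; _:=_; _:+_; _:*_; :-_; con)
  open Sums R

  Matrix : ℕ → Set c
  Matrix n = Fin n → Fin n → Carrier

  minor : ∀ {n} → Fin (suc n) → Fin (suc n) → Matrix (suc n) → Matrix n
  minor p q M a b = M (punchIn p a) (punchIn q b)

  σ : ∀ {n} → Fin n → Carrier
  σ i = sign (toℕ i)

  opaque
    unfolding ∑

    det : ∀ {n} → Matrix n → Carrier
    det = Ops.det

    det≡ : ∀ {n} (M : Matrix n) → det M ≡ Ops.det M
    det≡ M = ≡.refl

    det-nil : {M : Matrix 0} → det M ≡ 1#
    det-nil = ≡.refl

    det-cons : ∀ {n} (M : Matrix (suc n)) → det M ≡ ∑ (λ j → σ j * (M zero j * det (minor zero j M)))
    det-cons M = ≡.refl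

  det-cong : ∀ {n} {A B : Matrix n} → (∀ i j → A i j ≈ B i j) → det A ≈ det B
  det-cong {zero}  eq = reflexive (≡.trans det-nil (≡.sym det-nil))
  det-cong {suc n} {A} {B} eq = begin
    det A ≡⟨ det-cons A ⟩
    _     ≈⟨ ∑-cong (λ j → *-congˡ (*-cong (eq zero j) (det-cong (λ a b → eq (suc a) (punchIn j b))))) ⟩
    _     ≡⟨ det-cons B ⟨
    det B ∎

  det-scale : ∀ {n} x (M : Matrix n) → det (λ i j → x * M i j) ≈ x ^ n * det M
  det-scale {zero}  x M = trans (reflexive det-nil) (sym (trans (*-identityˡ _) (reflexive det-nil)))
  det-scale {suc n} x M = begin
    det (λ i j → x * M i j) ≡⟨ det-cons _ ⟩
    ∑ (λ j → σ j * ((x * M zero j) * det (λ a b → x * minor zero j M a b)))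
      ≈⟨ ∑-cong (λ j → trans
          (*-congˡ (*-congˡ (det-scale x (minor zero j M))))
          (solve 5 (λ s x m y d → s :* ((x :* m) :* (y :* d)) := (x :* y) :* (s :* (m :* d))) refl
            (σ j) x (M zero j) (x ^ n) (det (minor zero j M)))) ⟩
    ∑ (λ j → x ^ suc n * (σ j * (M zero j * det (minor zero j M))))
      ≈⟨ ∑-*ˡ (x ^ suc n) _ ⟩
    x ^ suc n * ∑ (λ j → σ j * (M zero j * det (minor zero j M)))
      ≡⟨ ≡.cong (x ^ suc n *_) (det-cons M) ⟨
    x ^ suc n * det M ∎

  sign-square : ∀ k → sign k * sign k ≈ 1#
  sign-square zero    = *-identityˡ 1#
  sign-square (suc k) = trans (solve 1 (λ s → :- s :* :- s := s :* s) refl (sign k)) (sign-square k)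

  -- Deleting one index of a pair lowers the position of the other by one exactly when the other is
  -- the larger. So one of the two orders has a position sum greater by one, and the signs are
  -- opposite.
  σ-punch : ∀ {m} (j : Fin (suc m)) k → σ (punchIn j k) * σ (punchBack j k) ≈ - (σ j * σ k)
  σ-punch {suc m} zero    k       =
    solve 1 (λ s → :- s :* con (ℤ.+ 1) := :- (con (ℤ.+ 1) :* s)) refl (σ k)
  σ-punch {suc m} (suc j) zero    =
    solve 1 (λ s → con (ℤ.+ 1) :* s := :- (:- s :* con (ℤ.+ 1))) refl (σ j)
  σ-punch {suc m} (suc j) (suc k) = trans
    (solve 2 (λ s t → :- s :* :- t := s :* t) refl _ _)
    (trans (σ-punch j k) (solve 2 (λ s t → :- (s :* t) := :- (:- s :* :- t)) refl (σ j) (σ k)))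

  -- After the defining expansion along row 0, row `suc p` is row `p` of each minor and can be
  -- expanded by induction. Reversing the order in which the two columns are chosen brings row
  -- `suc p` outside; the sign lost by `σ-punch` is the one that separates `σ p` from `σ (suc p)`.
  det-expand : ∀ {n} (p : Fin (suc n)) (M : Matrix (suc n)) →
    det M ≈ ∑ (λ q → (σ p * σ q) * (M p q * det (minor p q M)))
  det-expand         zero    M = trans (reflexive (det-cons M)) (∑-cong λ q → *-congʳ (sym (*-identityˡ (σ q))))
  det-expand {suc m} (suc p) M = begin
    det M ≡⟨ det-cons M ⟩
    _ ≈⟨ ∑-cong (λ j → trans
           (*-congˡ (*-congˡ (det-expand p (minor zero j M))))
           (trans (*-congˡ (sym (∑-*ˡ (M zero j) _))) (sym (∑-*ˡ (σ j) _)))) ⟩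
    ∑ (λ j → ∑ (term j))
      ≈⟨ ∑-swap-distinct term ⟩
    ∑ (λ j → ∑ (λ k → term (punchIn j k) (punchBack j k)))
      ≈⟨ ∑-cong (λ j → ∑-cong (λ k → reversed j k)) ⟩
    ∑ (λ j → ∑ (λ k → (- σ p * σ j) * (M (suc p) j * (σ k * (M zero (punchIn j k) * D j k)))))
      ≈⟨ ∑-cong (λ j → trans
           (∑-*ˡ (- σ p * σ j) _)
           (*-congˡ (trans (∑-*ˡ (M (suc p) j) _) (*-congˡ (reflexive (≡.sym (det-cons (minor (suc p) j M)))))))) ⟩
    ∑ (λ q → (- σ p * σ q) * (M (suc p) q * det (minor (suc p) q M))) ∎
    where
    D : Fin (suc (suc m)) → Fin (suc m) → Carrier
    D j k = det (λ a b → M (suc (punchIn p a)) (punchIn j (punchIn k b)))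

    term : Fin (suc (suc m)) → Fin (suc m) → Carrier
    term j k = σ j * (M zero j * ((σ p * σ k) * (M (suc p) (punchIn j k) * D j k)))

    reversed : ∀ j k → term (punchIn j k) (punchBack j k) ≈
      (- σ p * σ j) * (M (suc p) j * (σ k * (M zero (punchIn j k) * D j k)))
    reversed j k = begin
      term (punchIn j k) (punchBack j k)
        ≈⟨ *-congˡ (*-congˡ (*-congˡ (*-cong (reflexive (≡.cong (M (suc p)) (punchIn-punchBack j k)))
             (det-cong λ a b → reflexive (≡.cong (M _) (punchIn-comm j k b)))))) ⟩
      σ (punchIn j k) * (M zero (punchIn j k) * ((σ p * σ (punchBack j k)) * (M (suc p) j * D j k)))
        ≈⟨ solve 6 (λ s m₀ t s′ m d → s :* (m₀ :* ((t :* s′) :* (m :* d))) := (s :* s′) :* (t :* (m :* (m₀ :* d)))) refl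
             (σ (punchIn j k)) (M zero (punchIn j k)) (σ p) (σ (punchBack j k)) (M (suc p) j) (D j k) ⟩
      (σ (punchIn j k) * σ (punchBack j k)) * (σ p * (M (suc p) j * (M zero (punchIn j k) * D j k)))
        ≈⟨ *-congʳ (σ-punch j k) ⟩
      - (σ j * σ k) * (σ p * (M (suc p) j * (M zero (punchIn j k) * D j k)))
        ≈⟨ solve 6 (λ s s′ t m m₀ d → :- (s :* s′) :* (t :* (m :* (m₀ :* d))) := (:- t :* s) :* (m :* (s′ :* (m₀ :* d)))) refl
             (σ j) (σ k) (σ p) (M (suc p) j) (M zero (punchIn j k)) (D j k) ⟩
      (- σ p * σ j) * (M (suc p) j * (σ k * (M zero (punchIn j k) * D j k))) ∎

  -- Both equal rows are expanded. Exchanging the two chosen columns leaves the product of entries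
  -- and the double minor alone and flips the sign, so the terms cancel in pairs.
  det-alternating₀ : ∀ {m} (M : Matrix (suc (suc m))) (p : Fin (suc m)) →
    (∀ j → M zero j ≈ M (suc p) j) → det M ≈ 0#
  det-alternating₀ {m} M p eq = begin
    det M ≡⟨ det-cons M ⟩
    _ ≈⟨ ∑-cong (λ j → trans
           (*-congˡ (*-congˡ (det-expand p (minor zero j M))))
           (trans (*-congˡ (sym (∑-*ˡ (M zero j) _))) (sym (∑-*ˡ (σ j) _)))) ⟩
    ∑ (λ j → ∑ (term j))
      ≈⟨ ∑-antisymmetric term anti ⟩
    0# ∎
    where
    D : Fin (suc (suc m)) → Fin (suc m) → Carrier
    D j k = det (λ a b → M (suc (punchIn p a)) (punchIn j (punchIn k b)))

    term : Fin (suc (suc m)) → Fin (suc m) → Carrier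
    term j k = σ j * (M zero j * ((σ p * σ k) * (M (suc p) (punchIn j k) * D j k)))

    anti : ∀ j k → term (punchIn j k) (punchBack j k) ≈ - term j k
    anti j k = begin
      term (punchIn j k) (punchBack j k)
        ≈⟨ *-congˡ (*-cong (eq _) (*-congˡ (*-cong
             (trans (reflexive (≡.cong (M (suc p)) (punchIn-punchBack j k))) (sym (eq j)))
             (det-cong λ a b → reflexive (≡.cong (M _) (punchIn-comm j k b)))))) ⟩
      σ (punchIn j k) * (M (suc p) (punchIn j k) * ((σ p * σ (punchBack j k)) * (M zero j * D j k)))
        ≈⟨ solve 6 (λ s m t s′ m₀ d → s :* (m :* ((t :* s′) :* (m₀ :* d))) := (s :* s′) :* (t :* (m₀ :* (m :* d)))) refl
             (σ (punchIn j k)) (M (suc p) (punchIn j k)) (σ p) (σ (punchBack j k)) (M zero j) (D j k) ⟩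
      (σ (punchIn j k) * σ (punchBack j k)) * (σ p * (M zero j * (M (suc p) (punchIn j k) * D j k)))
        ≈⟨ *-congʳ (σ-punch j k) ⟩
      - (σ j * σ k) * (σ p * (M zero j * (M (suc p) (punchIn j k) * D j k)))
        ≈⟨ solve 6 (λ s s′ t m₀ m d → :- (s :* s′) :* (t :* (m₀ :* (m :* d))) := :- (s :* (m₀ :* ((t :* s′) :* (m :* d))))) refl
             (σ j) (σ k) (σ p) (M zero j) (M (suc p) (punchIn j k)) (D j k) ⟩
      - term j k ∎

  det-alternating : ∀ {n} (M : Matrix n) {p q : Fin n} → p ≢ q →
    (∀ j → M p j ≈ M q j) → det M ≈ 0#
  det-alternating {suc n}       M {zero}  {zero}  p≢q eq = ⊥-elim (p≢q ≡.refl)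
  det-alternating {suc (suc n)} M {zero}  {suc q} p≢q eq = det-alternating₀ M q eq
  det-alternating {suc (suc n)} M {suc p} {zero}  p≢q eq = det-alternating₀ M p (sym ∘ eq)
  det-alternating {suc n}       M {suc p} {suc q} p≢q eq = trans (reflexive (det-cons M)) (∑-zero λ j → trans
    (*-congˡ (trans (*-congˡ (det-alternating (minor zero j M) (p≢q ∘ ≡.cong suc) (eq ∘ punchIn j))) (zeroʳ _)))
    (zeroʳ _))

  det-row-linear : ∀ {n} (p : Fin n) x {A B C : Matrix n} →
    (∀ i j → i ≢ p → A i j ≈ C i j) → (∀ i j → i ≢ p → B i j ≈ C i j) →
    (∀ j → C p j ≈ A p j + x * B p j) → det C ≈ det A + x * det B
  det-row-linear {suc n} p x {A} {B} {C} A≈C B≈C row = begin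
    det C ≈⟨ det-expand p C ⟩
    ∑ (λ q → (σ p * σ q) * (C p q * det (minor p q C)))
      ≈⟨ ∑-cong (λ q → trans
           (*-congˡ (*-congʳ (row q)))
           (trans (solve 5 (λ s a x b d → s :* ((a :+ x :* b) :* d) := s :* (a :* d) :+ x :* (s :* (b :* d))) refl
              (σ p * σ q) (A p q) x (B p q) (det (minor p q C)))
             (+-cong
               (*-congˡ (*-congˡ (det-cong λ a b → sym (A≈C _ _ (punchInᵢ≢i p a)))))
               (*-congˡ (*-congˡ (*-congˡ (det-cong λ a b → sym (B≈C _ _ (punchInᵢ≢i p a))))))))) ⟩
    ∑ (λ q → (σ p * σ q) * (A p q * det (minor p q A)) + x * ((σ p * σ q) * (B p q * det (minor p q B))))
      ≈⟨ trans (∑-+ _ _) (+-congˡ (∑-*ˡ x _)) ⟩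
    _ ≈⟨ +-cong (det-expand p A) (*-congˡ (det-expand p B)) ⟨
    det A + x * det B ∎

  det-unit-row : ∀ {n} (p : Fin (suc n)) (M : Matrix (suc n)) →
    M p p ≈ 1# → (∀ j → j ≢ p → M p j ≈ 0#) → det M ≈ det (minor p p M)
  det-unit-row {n} p M one off = begin
    det M ≈⟨ det-expand p M ⟩
    ∑ (λ q → (σ p * σ q) * (M p q * det (minor p q M)))
      ≈⟨ ∑-single p _ (λ q q≢p → trans (*-congˡ (trans (*-congʳ (off q q≢p)) (zeroˡ _))) (zeroʳ _)) ⟩
    (σ p * σ p) * (M p p * det (minor p p M))
      ≈⟨ *-cong (sign-square (toℕ p)) (*-congʳ one) ⟩
    1# * (1# * det (minor p p M)) ≈⟨ trans (*-identityˡ _) (*-identityˡ _) ⟩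
    det (minor p p M) ∎

  det-identity : ∀ {n} (M : Matrix n) → (∀ i → M i i ≈ 1#) → (∀ i j → j ≢ i → M i j ≈ 0#) → det M ≈ 1#
  det-identity {zero}  M one off = reflexive det-nil
  det-identity {suc n} M one off = trans (det-unit-row zero M (one zero) (off zero))
    (det-identity (minor zero zero M) (one ∘ suc) (λ i j j≢i → off (suc i) (suc j) (j≢i ∘ suc-injective)))

  -- The sum of `z i * E i` is the determinant with row `v` replaced by the vanishing combination of
  -- rows. Here `E i` has row `i` copied into row `v`: for `i ≢ v` two rows agree and it is 0, while
  -- `E v` is `det M`. As `z v` is 1, nothing has to be divided.
  det-dependent : ∀ {n} (M : Matrix n) (z : Fin n → Carrier) (v : Fin n) → z v ≈ 1# →
    (∀ j → ∑ (λ i → z i * M i j) ≈ 0#) → det M ≈ 0#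
  det-dependent {suc n} M z v zv≈1 ker = begin
    det M                               ≈⟨ det-expand v M ⟩
    E v                                 ≈⟨ *-identityˡ _ ⟨
    1# * E v                            ≈⟨ *-congʳ zv≈1 ⟨
    z v * E v                           ≈⟨ ∑-single v _ (λ i i≢v → trans (*-congˡ (E-off i i≢v)) (zeroʳ _)) ⟨
    ∑ (λ i → z i * E i)      ≈⟨ ∑-cong (λ i → ∑-*ˡ (z i) _) ⟨
    ∑ (λ i → ∑ (λ q → z i * ((σ v * σ q) * (M i q * D q))))
      ≈⟨ ∑-swap _ ⟩
    ∑ (λ q → ∑ (λ i → z i * ((σ v * σ q) * (M i q * D q))))
      ≈⟨ ∑-cong (λ q → trans
           (∑-cong (λ i → solve 4 (λ z s m d → z :* (s :* (m :* d)) := (s :* d) :* (z :* m)) refl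
             (z i) (σ v * σ q) (M i q) (D q)))
           (trans (∑-*ˡ _ _) (trans (*-congˡ (ker q)) (zeroʳ _)))) ⟩
    ∑ (λ _ → 0#)             ≈⟨ ∑-zero (λ _ → refl) ⟩
    0# ∎
    where
    D : Fin (suc n) → Carrier
    D q = det (minor v q M)

    E : Fin (suc n) → Carrier
    E i = ∑ (λ q → (σ v * σ q) * (M i q * D q))

    M[v≔_] : Fin (suc n) → Matrix (suc n)
    M[v≔ i ] a b = if does (a ≟ v) then M i b else M a b

    at-v : ∀ i b → M[v≔ i ] v b ≡ M i b
    at-v i b rewrite dec-true (v ≟ v) ≡.refl = ≡.refl

    off-v : ∀ i a b → a ≢ v → M[v≔ i ] a b ≡ M a b
    off-v i a b a≢v rewrite dec-false (a ≟ v) a≢v = ≡.refl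

    E-off : ∀ i → i ≢ v → E i ≈ 0#
    E-off i i≢v = begin
      E i ≈⟨ ∑-cong (λ q → *-congˡ (*-cong (reflexive (≡.sym (at-v i q)))
               (det-cong λ a b → reflexive (≡.sym (off-v i _ _ (punchInᵢ≢i v a)))))) ⟩
      _   ≈⟨ det-expand v M[v≔ i ] ⟨
      det M[v≔ i ]
        ≈⟨ det-alternating M[v≔ i ] i≢v (λ j → reflexive (≡.trans (off-v i i j i≢v) (≡.sym (at-v i j)))) ⟩
      0# ∎

-- Unit rows, principal minors and diagonal perturbations

-- The perturbed rows are presented as the image of `f`, so that an induction on `k` can add them
-- one at a time and end with `f = id`.
inImage : ∀ {k n} → (Fin k → Fin n) → Fin n → Bool
inImage {zero}  f i = false
inImage {suc k} f i = does (f zero ≟ i) ∨ inImage (f ∘ suc) i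

inImage-complete : ∀ {k n} (f : Fin k → Fin n) a → inImage f (f a) ≡ true
inImage-complete f zero    rewrite dec-true (f zero ≟ f zero) ≡.refl = ≡.refl
inImage-complete f (suc a) rewrite inImage-complete (f ∘ suc) a = Boolₚ.∨-zeroʳ _

inImage-avoids : ∀ {k n} (f : Fin k → Fin n) i → (∀ a → f a ≢ i) → inImage f i ≡ false
inImage-avoids {zero}  f i f≢i = ≡.refl
inImage-avoids {suc k} f i f≢i
  rewrite dec-false (f zero ≟ i) (f≢i zero) = inImage-avoids (f ∘ suc) i (f≢i ∘ suc)

module UnitRows {c ℓ} (R : CommutativeRing c ℓ) where
  open CommutativeRing R hiding (zero)
  open RingOps rawRing hiding (det)
  open Relation.Binary.Reasoning.Setoid setoid
  open IntegerSolver R using (solve; _:=_; _:+_; _:*_; con)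
  open Sums R
  open Determinants R

  𝟙 : ∀ {n} → Matrix n
  𝟙 i j = if does (i ≟ j) then 1# else 0#

  𝟙-diag : ∀ {n} (i : Fin n) → 𝟙 i i ≈ 1#
  𝟙-diag i rewrite dec-true (i ≟ i) ≡.refl = refl

  𝟙-off : ∀ {n} {i j : Fin n} → i ≢ j → 𝟙 i j ≈ 0#
  𝟙-off {i = i} {j} i≢j rewrite dec-false (i ≟ j) i≢j = refl

  unitRows : ∀ {n} → (Fin n → Bool) → Matrix n → Matrix n
  unitRows X M i j = if X i then 𝟙 i j else M i j

  unitRow : ∀ {n} → Fin n → Matrix n → Matrix n
  unitRow p = unitRows ⁅ p ⁆

  unitRow-at : ∀ {n} (p : Fin n) M j → unitRow p M p j ≈ 𝟙 p j
  unitRow-at p M j rewrite dec-true (p ≟ p) ≡.refl = refl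

  unitRow-off : ∀ {n} (p : Fin n) M {i} j → i ≢ p → unitRow p M i j ≈ M i j
  unitRow-off p M {i} j i≢p rewrite dec-false (i ≟ p) i≢p = refl

  det-unitRow : ∀ {n} (p : Fin (suc n)) M → det (unitRow p M) ≈ det (minor p p M)
  det-unitRow p M = trans
    (det-unit-row p (unitRow p M) (trans (unitRow-at p M p) (𝟙-diag p))
      (λ j j≢p → trans (unitRow-at p M j) (𝟙-off (j≢p ∘ ≡.sym))))
    (det-cong λ a b → unitRow-off p M _ (punchInᵢ≢i p a))

  det-unitRow₂ : ∀ {n} (p q : Fin (suc (suc n))) M (p≢q : p ≢ q) →
    det (unitRow q (unitRow p M)) ≈ det (delete2 M p q p≢q)
  det-unitRow₂ p q M p≢q = begin
    det N
      ≈⟨ det-unit-row p N (trans (row-p p) (𝟙-diag p)) (λ j j≢p → trans (row-p j) (𝟙-off (j≢p ∘ ≡.sym))) ⟩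
    det (minor p p N)
      ≈⟨ det-unit-row q′ (minor p p N) (trans (row-q q′) (trans (reflexive (≡.cong (𝟙 q) inj)) (𝟙-diag q)))
           (λ j j≢q′ → trans (row-q j) (𝟙-off λ q≡ → j≢q′ (punchIn-injective p j q′ (≡.sym (≡.trans inj q≡))))) ⟩
    det (minor q′ q′ (minor p p N))
      ≈⟨ det-cong (λ a b → trans
           (unitRow-off q (unitRow p M) _ (λ eq → punchInᵢ≢i q′ a (punchIn-injective p _ q′ (≡.trans eq (≡.sym inj)))))
           (unitRow-off p M _ (punchInᵢ≢i p _))) ⟩
    det (delete2 M p q p≢q) ∎
    where
    N   = unitRow q (unitRow p M)
    q′  = punchOut p≢q
    inj = punchIn-punchOut p≢q

    row-p : ∀ j → N p j ≈ 𝟙 p j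
    row-p j = trans (unitRow-off q (unitRow p M) j p≢q) (unitRow-at p M j)

    row-q : ∀ j → minor p p N q′ j ≈ 𝟙 q (punchIn p j)
    row-q j = trans (reflexive (≡.cong (λ i → N i (punchIn p j)) inj)) (unitRow-at q (unitRow p M) _)

  det-unitRow-scale : ∀ {n} (p : Fin (suc n)) x M →
    det (unitRow p (λ i j → x * M i j)) ≈ x ^ n * det (unitRow p M)
  det-unitRow-scale p x M = trans (det-unitRow p _)
    (trans (det-scale x (minor p p M)) (*-congˡ (sym (det-unitRow p M))))

  -- The factor `x * x` stands in for the two unit rows, which are not scaled; it makes the exponent
  -- `n` and avoids a truncated subtraction.
  det-unitRow₂-scale : ∀ {n} (p q : Fin n) x M → p ≢ q →
    (x * x) * det (unitRow q (unitRow p (λ i j → x * M i j))) ≈ x ^ n * detDel2 M p q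
  det-unitRow₂-scale {suc zero}    zero zero x M p≢q = ⊥-elim (p≢q ≡.refl)
  det-unitRow₂-scale {suc (suc m)} p q x M p≢q with p ≟ q
  ... | yes p≡q = ⊥-elim (p≢q p≡q)
  ... | no  p≢q′ = begin
    (x * x) * det (unitRow q (unitRow p (λ i j → x * M i j))) ≈⟨ *-congˡ (det-unitRow₂ p q _ p≢q′) ⟩
    (x * x) * det (λ a b → x * delete2 M p q p≢q′ a b)        ≈⟨ *-congˡ (det-scale x _) ⟩
    (x * x) * (x ^ m * det (delete2 M p q p≢q′))
      ≈⟨ solve 3 (λ x y d → (x :* x) :* (y :* d) := (x :* (x :* y)) :* d) refl x (x ^ m) _ ⟩
    x ^ suc (suc m) * det (delete2 M p q p≢q′)                ≡⟨ ≡.cong (x ^ suc (suc m) *_) (det≡ _) ⟩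
    x ^ suc (suc m) * RingOps.det rawRing (delete2 M p q p≢q′) ∎

  ∑< : ∀ {n} → (Fin n → Fin n → Carrier) → Carrier
  ∑< h = ∑ λ p → ∑ λ q → if toℕ p <ᵇ toℕ q then h p q else 0#

  ∑<-cons : ∀ {n} (h : Fin (suc n) → Fin (suc n) → Carrier) →
    ∑< h ≈ ∑ (λ q → h zero (suc q)) + ∑< (λ p q → h (suc p) (suc q))
  ∑<-cons h = trans (reflexive (∑-cons _)) (+-cong
    (trans (reflexive (∑-cons _)) (+-identityˡ _))
    (∑-cong λ p → trans (reflexive (∑-cons _)) (+-identityˡ _)))

  module DiagonalPerturbation {n} (y : Carrier) (y³≈0 : y * (y * y) ≈ 0#) (g : Fin n → Carrier) where

    perturb : ∀ {k} → (Fin k → Fin n) → Matrix n → Matrix n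
    perturb f M i j = M i j + (if inImage f i then (y * g i) * 𝟙 i j else 0#)

    -- By injectivity no later index perturbs row `f zero` again, so this row is that of `M` plus a
    -- multiple of a unit vector, and linearity in it separates the two.
    det-perturb-step : ∀ {k} (f : Fin (suc k) → Fin n) → (∀ {a b} → f a ≡ f b → a ≡ b) → ∀ M →
      det (perturb f M) ≈
      det (perturb (f ∘ suc) M) + (y * g (f zero)) * det (perturb (f ∘ suc) (unitRow (f zero) M))
    det-perturb-step f f-inj M = det-row-linear (f zero) (y * g (f zero))
      (λ i j i≢p → +-congˡ (reflexive (Boolₚ.if-cong (≡.sym (off i i≢p)))))
      (λ i j i≢p → +-cong (unitRow-off (f zero) M j i≢p) (reflexive (Boolₚ.if-cong (≡.sym (off i i≢p)))))
      (λ j → begin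
        perturb f M (f zero) j
          ≈⟨ +-congˡ (reflexive (Boolₚ.if-cong (inImage-complete f zero))) ⟩
        M (f zero) j + (y * g (f zero)) * 𝟙 (f zero) j
          ≈⟨ solve 3 (λ m x e → m :+ x :* e := (m :+ con (ℤ.+ 0)) :+ x :* (e :+ con (ℤ.+ 0))) refl
               (M (f zero) j) (y * g (f zero)) (𝟙 (f zero) j) ⟩
        (M (f zero) j + 0#) + (y * g (f zero)) * (𝟙 (f zero) j + 0#)
          ≈⟨ +-cong (+-congˡ (reflexive (Boolₚ.if-cong fresh)))
               (*-congˡ (+-cong (unitRow-at (f zero) M j) (reflexive (Boolₚ.if-cong fresh)))) ⟨
        perturb (f ∘ suc) M (f zero) j + (y * g (f zero)) * perturb (f ∘ suc) (unitRow (f zero) M) (f zero) j ∎)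
      where
      off : ∀ i → i ≢ f zero → inImage f i ≡ inImage (f ∘ suc) i
      off i i≢p rewrite dec-false (f zero ≟ i) (i≢p ∘ ≡.sym) = ≡.refl

      fresh : inImage (f ∘ suc) (f zero) ≡ false
      fresh = inImage-avoids (f ∘ suc) (f zero) (λ a eq → case f-inj eq of λ ())

    first : ∀ {k} → (Fin k → Fin n) → Matrix n → Carrier
    first f M = ∑ λ a → g (f a) * det (unitRow (f a) M)

    second : ∀ {k} → (Fin k → Fin n) → Matrix n → Carrier
    second f M = ∑< λ a b → g (f a) * (g (f b) * det (unitRow (f b) (unitRow (f a) M)))

    -- The induction must allow every `M`, because it is also applied to `M` with row `f zero`
    -- already made a unit vector. That copy carries a factor `y`, so its second-order part enters
    -- only with y³.
    det-perturb : ∀ {k} (f : Fin k → Fin n) → (∀ {a b} → f a ≡ f b → a ≡ b) → ∀ M →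
      det (perturb f M) ≈ (det M + y * first f M) + (y * y) * second f M
    det-perturb {zero} f f-inj M = begin
      det (perturb f M) ≈⟨ det-cong (λ i j → +-identityʳ (M i j)) ⟩
      det M
        ≈⟨ solve 2 (λ d y → d := (d :+ y :* con (ℤ.+ 0)) :+ (y :* y) :* con (ℤ.+ 0)) refl (det M) y ⟩
      (det M + y * 0#) + (y * y) * 0#
        ≡⟨ ≡.cong₂ (λ a b → (det M + y * a) + (y * y) * b) ∑-nil ∑-nil ⟨
      (det M + y * first f M) + (y * y) * second f M ∎
    det-perturb {suc k} f f-inj M = begin
      det (perturb f M)
        ≈⟨ det-perturb-step f f-inj M ⟩
      det (perturb f′ M) + (y * g₀) * det (perturb f′ U)
        ≈⟨ +-cong (det-perturb f′ f′-inj M) (*-congˡ (det-perturb f′ f′-inj U)) ⟩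
      ((det M + y * first f′ M) + (y * y) * second f′ M)
        + (y * g₀) * ((det U + y * first f′ U) + (y * y) * second f′ U)
        ≈⟨ solve 8 (λ d s p y g d′ s′ p′ →
               ((d :+ y :* s) :+ (y :* y) :* p) :+ (y :* g) :* ((d′ :+ y :* s′) :+ (y :* y) :* p′)
             := (d :+ y :* (g :* d′ :+ s)) :+ (y :* y) :* (g :* s′ :+ p) :+ (y :* (y :* y)) :* (g :* p′)) refl
             (det M) (first f′ M) (second f′ M) y g₀ (det U) (first f′ U) (second f′ U) ⟩
      (det M + y * (g₀ * det U + first f′ M)) + (y * y) * (g₀ * first f′ U + second f′ M)
        + (y * (y * y)) * (g₀ * second f′ U)
        ≈⟨ trans (+-congˡ (trans (*-congʳ y³≈0) (zeroˡ _))) (+-identityʳ _) ⟩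
      (det M + y * (g₀ * det U + first f′ M)) + (y * y) * (g₀ * first f′ U + second f′ M)
        ≈⟨ +-cong (+-congˡ (*-congˡ (reflexive (∑-cons _))))
             (*-congˡ (trans (∑<-cons _) (+-congʳ (∑-*ˡ g₀ _)))) ⟨
      (det M + y * first f M) + (y * y) * second f M ∎
      where
      f′ = f ∘ suc
      g₀ = g (f zero)
      U  = unitRow (f zero) M

      f′-inj : ∀ {a b} → f′ a ≡ f′ b → a ≡ b
      f′-inj = suc-injective ∘ f-inj

    det-diagonal : ∀ M → det (λ i j → M i j + (y * g i) * 𝟙 i j) ≈
      (det M + y * (∑ λ p → g p * det (unitRow p M)))
        + (y * y) * (∑< λ p q → g p * (g q * det (unitRow q (unitRow p M))))
    det-diagonal M = trans
      (det-cong λ i j → +-congˡ (reflexive (Boolₚ.if-cong (≡.sym (inImage-complete id i)))))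
      (det-perturb id id M)

-- Vertex sets as Boolean functions

does⁺ : ∀ {a} {A : Set a} (a? : Dec A) → A → T (does a?)
does⁺ (yes _) a = _
does⁺ (no ¬a) a = ⊥-elim (¬a a)

does⁻ : ∀ {a} {A : Set a} (a? : Dec A) → T (does a?) → A
does⁻ (yes a) _ = a

T-ext : ∀ {x y} → (T x → T y) → (T y → T x) → x ≡ y
T-ext f g = Boolₚ.⇔→≡ (mk⇔ (to T-≡ ∘ f ∘ from T-≡) (to T-≡ ∘ g ∘ from T-≡))

≡ᵇ≡does : ∀ {n} (i j : Fin n) → (toℕ i ≡ᵇ toℕ j) ≡ does (i ≟ j)
≡ᵇ≡does i j = T-ext
  (λ p → does⁺ (i ≟ j) (toℕ-injective (ℕₚ.≡ᵇ⇒≡ _ _ p)))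
  (λ p → ℕₚ.≡⇒≡ᵇ _ _ (≡.cong toℕ (does⁻ (i ≟ j) p)))

-- This n - |X| has two uses: it is the number of edges of a spanning forest with one root in X per
-- tree, and it decreases while the closure of X still grows.
misses : ∀ {n} → (Fin n → Bool) → ℕ
misses {zero}  X = 0
misses {suc n} X = (if X zero then 0 else 1) ℕ.+ misses (X ∘ suc)

insert : ∀ {n} → Fin n → (Fin n → Bool) → Fin n → Bool
insert b X v = does (v ≟ b) ∨ X v

misses≤n : ∀ {n} (X : Fin n → Bool) → misses X ≤ n
misses≤n {zero}  X = z≤n
misses≤n {suc n} X with X zero
... | true  = ℕₚ.m≤n⇒m≤1+n (misses≤n (X ∘ suc))
... | false = s≤s (misses≤n (X ∘ suc))

misses-cong : ∀ {n} {X Y : Fin n → Bool} → (∀ v → X v ≡ Y v) → misses X ≡ misses Y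
misses-cong {zero}  eq = ≡.refl
misses-cong {suc n} eq = ≡.cong₂ (λ x m → (if x then 0 else 1) ℕ.+ m) (eq zero) (misses-cong (eq ∘ suc))

misses-mono : ∀ {n} {X Y : Fin n → Bool} → (∀ v → T (X v) → T (Y v)) → misses Y ≤ misses X
misses-mono {zero}          X⊆Y = z≤n
misses-mono {suc n} {X} {Y} X⊆Y with X zero | Y zero | X⊆Y zero
... | true  | true  | _ = misses-mono (X⊆Y ∘ suc)
... | true  | false | f = ⊥-elim (f _)
... | false | true  | _ = ℕₚ.m≤n⇒m≤1+n (misses-mono (X⊆Y ∘ suc))
... | false | false | _ = s≤s (misses-mono (X⊆Y ∘ suc))

misses-insert : ∀ {n} (X : Fin n → Bool) b → X b ≡ false → misses X ≡ suc (misses (insert b X))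
misses-insert X zero    Xb≡f rewrite Xb≡f = ≡.refl
misses-insert X (suc b) Xb≡f = ≡.trans
  (≡.cong ((if X zero then 0 else 1) ℕ.+_) (misses-insert (X ∘ suc) b Xb≡f))
  (ℕₚ.+-suc (if X zero then 0 else 1) _)

misses-strict : ∀ {n} {X Y : Fin n → Bool} → (∀ v → T (X v) → T (Y v)) →
  ∀ b → X b ≡ false → T (Y b) → misses Y < misses X
misses-strict {X = X} {Y} X⊆Y b Xb≡f Yb =
  ≡.subst (misses Y <_) (≡.sym (misses-insert X b Xb≡f)) (s≤s (misses-mono insert⊆Y))
  where
  insert⊆Y : ∀ v → T (insert b X v) → T (Y v)
  insert⊆Y v p with v ≟ b
  ... | yes ≡.refl = Yb
  ... | no _       = X⊆Y v p

misses≡0 : ∀ {n} (X : Fin n → Bool) → misses X ≡ 0 → ∀ v → X v ≡ true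
misses≡0 X eq v with X v in Xv
... | true  = ≡.refl
... | false with () ← ≡.trans (≡.sym eq) (misses-insert X v Xv)

misses-positive : ∀ {n} (X : Fin n → Bool) {k} → misses X ≡ suc k → ∃ λ v → X v ≡ false
misses-positive {suc n} X eq with X zero in X0
... | false = zero , X0
... | true with v , Xv ← misses-positive (X ∘ suc) eq = suc v , Xv

misses-empty : ∀ n → misses {n} (λ _ → false) ≡ n
misses-empty zero    = ≡.refl
misses-empty (suc n) = ≡.cong suc (misses-empty n)

misses-singleton : ∀ {n} (p : Fin (suc n)) → misses ⁅ p ⁆ ≡ n
misses-singleton {n} p = ℕₚ.suc-injective (≡.trans
  (≡.cong suc (misses-cong {X = ⁅ p ⁆} (λ v → ≡.sym (Boolₚ.∨-identityʳ _))))
  (≡.trans (≡.sym (misses-insert (λ _ → false) p ≡.refl)) (misses-empty (suc n))))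

-- Reachability from a vertex set

module Reachability {n : ℕ} where

  Edge : Set
  Edge = Fin n × Fin n

  data Reach (X : Fin n → Bool) (S : List Edge) : Fin n → Set where
    root     : ∀ {v} → T (X v) → Reach X S v
    forward  : ∀ {a b} → (a , b) ∈ S → Reach X S a → Reach X S b
    backward : ∀ {a b} → (a , b) ∈ S → Reach X S b → Reach X S a

  Closed : List Edge → (Fin n → Bool) → Set
  Closed S Y = ∀ {a b} → (a , b) ∈ S → (T (Y a) → T (Y b)) × (T (Y b) → T (Y a))

  Reach-least : ∀ {X S Y} → (∀ v → T (X v) → T (Y v)) → Closed S Y → ∀ {v} → Reach X S v → T (Y v)
  Reach-least X⊆Y cl (root x)      = X⊆Y _ x
  Reach-least X⊆Y cl (forward e r)  = proj₁ (cl e) (Reach-least X⊆Y cl r)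
  Reach-least X⊆Y cl (backward e r) = proj₂ (cl e) (Reach-least X⊆Y cl r)

  Reach-mono : ∀ {X S S′} → (∀ {e} → e ∈ S → e ∈ S′) → ∀ {v} → Reach X S v → Reach X S′ v
  Reach-mono S⊆S′ (root x)      = root x
  Reach-mono S⊆S′ (forward e r)  = forward (S⊆S′ e) (Reach-mono S⊆S′ r)
  Reach-mono S⊆S′ (backward e r) = backward (S⊆S′ e) (Reach-mono S⊆S′ r)

  Reach-bind : ∀ {X Y S} → (∀ v → T (X v) → Reach Y S v) → ∀ {v} → Reach X S v → Reach Y S v
  Reach-bind f (root x)      = f _ x
  Reach-bind f (forward e r)  = forward e (Reach-bind f r)
  Reach-bind f (backward e r) = backward e (Reach-bind f r)

  Reach-singleton : ∀ {p S} → Reach ⁅ p ⁆ S p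
  Reach-singleton {p} = root (does⁺ (p ≟ p) ≡.refl)

  Reach-trans : ∀ {p q r S} → Reach ⁅ p ⁆ S q → Reach ⁅ q ⁆ S r → Reach ⁅ p ⁆ S r
  Reach-trans {p} {q} {S = S} pq = Reach-bind λ v v∈q →
    ≡.subst (Reach ⁅ p ⁆ S) (≡.sym (does⁻ (v ≟ q) v∈q)) pq

  Reach-sym : ∀ {p q S} → Reach ⁅ p ⁆ S q → Reach ⁅ q ⁆ S p
  Reach-sym {p} {q} {S} (root {v} x)  =
    ≡.subst (λ z → Reach ⁅ z ⁆ S p) (≡.sym (does⁻ (v ≟ p) x)) Reach-singleton
  Reach-sym (forward e r)  = Reach-trans (backward e Reach-singleton) (Reach-sym r)
  Reach-sym (backward e r) = Reach-trans (forward e Reach-singleton) (Reach-sym r)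

  touches : (Fin n → Bool) → Fin n → Edge → Bool
  touches X v (a , b) = (does (a ≟ v) ∧ X b) ∨ (does (b ≟ v) ∧ X a)

  spread : List Edge → (Fin n → Bool) → Fin n → Bool
  spread S X v = X v ∨ any (touches X v) S

  closure : (Fin n → Bool) → List Edge → ℕ → Fin n → Bool
  closure X S zero    = X
  closure X S (suc k) = spread S (closure X S k)

  spread-Reach : ∀ {X S Y} → (∀ v → T (Y v) → Reach X S v) → ∀ v → T (spread S Y v) → Reach X S v
  spread-Reach {X} {S} {Y} f v p with to (T-∨ {Y v}) p
  ... | inj₁ y = f v y
  ... | inj₂ q with find (Anyₚ.any⁻ (touches Y v) S q)
  ...   | (a , b) , e∈S , t with to (T-∨ {does (a ≟ v) ∧ Y b}) t
  ...     | inj₁ av with a≡v , yb ← to (T-∧ {does (a ≟ v)}) av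
    = ≡.subst (Reach X S) (does⁻ (a ≟ v) a≡v) (backward e∈S (f b yb))
  ...     | inj₂ bv with b≡v , ya ← to (T-∧ {does (b ≟ v)}) bv
    = ≡.subst (Reach X S) (does⁻ (b ≟ v) b≡v) (forward e∈S (f a ya))

  closure-sound : ∀ X S k v → T (closure X S k v) → Reach X S v
  closure-sound X S zero    v = root
  closure-sound X S (suc k) v = spread-Reach (closure-sound X S k) v

  closure-mono : ∀ X S k v → T (closure X S k v) → T (closure X S (suc k) v)
  closure-mono X S k v p = from T-∨ (inj₁ p)

  closure-extensive : ∀ X S k v → T (X v) → T (closure X S k v)
  closure-extensive X S zero    v p = p
  closure-extensive X S (suc k) v p = closure-mono X S k v (closure-extensive X S k v p)

  fixed⇒Closed : ∀ S Y → (∀ v → T (spread S Y v) → T (Y v)) → Closed S Y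
  fixed⇒Closed S Y fixed {a} {b} e∈S =
    (λ ya → fixed b (from (T-∨ {Y b}) (inj₂ (Anyₚ.any⁺ (touches Y b)
      (lose e∈S (from (T-∨ {does (a ≟ b) ∧ Y b}) (inj₂ (from T-∧ (does⁺ (b ≟ b) ≡.refl , ya)))))))))
    , (λ yb → fixed a (from (T-∨ {Y a}) (inj₂ (Anyₚ.any⁺ (touches Y a)
      (lose e∈S (from T-∨ (inj₁ (from T-∧ (does⁺ (a ≟ a) ≡.refl , yb)))))))))

  Closed⇒fixed : ∀ S Y → Closed S Y → ∀ v → T (spread S Y v) → T (Y v)
  Closed⇒fixed S Y cl v p = Reach-least (λ _ → id) cl (spread-Reach {Y} {S} (λ _ → root) v p)

  stable⇒Closed : ∀ X S k → (∀ v → T (closure X S (suc k) v) → T (closure X S k v)) →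
    Closed S (closure X S (suc k))
  stable⇒Closed X S k stable e =
    (λ p → closure-mono X S k _ (proj₁ (fixed⇒Closed S _ stable e) (stable _ p)))
    , (λ p → closure-mono X S k _ (proj₂ (fixed⇒Closed S _ stable e) (stable _ p)))

  -- Each round of spreading either adds a vertex or has already stabilised.
  closure-progress : ∀ X S k → Closed S (closure X S k) ⊎ misses (closure X S k) ℕ.+ k ≤ n
  closure-progress X S zero    = inj₂ (≡.subst (_≤ n) (≡.sym (ℕₚ.+-identityʳ _)) (misses≤n X))
  closure-progress X S (suc k) with closure-progress X S k
  ... | inj₁ cl = inj₁ (stable⇒Closed X S k (Closed⇒fixed S _ cl))
  ... | inj₂ le with Finₚ.any? (λ v → T? (closure X S (suc k) v) ×-dec ¬? (T? (closure X S k v)))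
  ...   | yes (v , new , old) = inj₂ (≡.subst (_≤ n) (≡.sym (ℕₚ.+-suc _ k))
            (ℕₚ.≤-trans (ℕₚ.+-monoˡ-≤ k (misses-strict (closure-mono X S k) v (Boolₚ.¬-not (old ∘ from T-≡)) new)) le))
  ...   | no none = inj₁ (stable⇒Closed X S k λ v p → decidable-stable (T? _) (λ ¬q → none (v , p , ¬q)))

  closure-Closed : ∀ X S → Closed S (closure X S n)
  closure-Closed X S with closure-progress X S n
  ... | inj₁ cl = cl
  -- Here `le` leaves no vertex missed after `n` rounds, and the set of all vertices is closed.
  ... | inj₂ le = λ _ → (λ _ → full _) , (λ _ → full _)
    where
    full : ∀ v → T (closure X S n v)
    full v = from T-≡ (misses≡0 (closure X S n) (ℕₚ.n≤0⇒n≡0 (ℕₚ.+-cancelʳ-≤ n _ 0 le)) v)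

  closure-complete : ∀ {X S v} → Reach X S v → T (closure X S n v)
  closure-complete {X} {S} = Reach-least (closure-extensive X S n) (closure-Closed X S)

  spans : (Fin n → Bool) → List Edge → Bool
  spans X S = all (closure X S n) (allFin n)

  all-allFin⁺ : ∀ (f : Fin n → Bool) → (∀ v → T (f v)) → T (all f (allFin n))
  all-allFin⁺ f p = Allₚ.all⁻ f {xs = allFin n} (All.tabulate λ {v} _ → p v)

  all-allFin⁻ : ∀ (f : Fin n → Bool) → T (all f (allFin n)) → ∀ v → T (f v)
  all-allFin⁻ f p v = All.lookup (Allₚ.all⁺ f (allFin n) p) (∈-allFin v)

  spans⁺ : ∀ X S → (∀ v → Reach X S v) → T (spans X S)
  spans⁺ X S r = all-allFin⁺ _ (closure-complete ∘ r)

  spans⁻ : ∀ X S → T (spans X S) → ∀ v → Reach X S v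
  spans⁻ X S p v = closure-sound X S n v (all-allFin⁻ _ p v)

  spans-mono : ∀ X {S S′} → (∀ {e} → e ∈ S → e ∈ S′) → T (spans X S) → T (spans X S′)
  spans-mono X S⊆S′ p = spans⁺ X _ (Reach-mono S⊆S′ ∘ spans⁻ X _ p)

  Noncrossing : (Fin n → Bool) → Edge → Set
  Noncrossing X (a , b) = X a ≡ X b

  noncrossing-Reach : ∀ {X S} → All (Noncrossing X) S → ∀ {v} → Reach X S v → T (X v)
  noncrossing-Reach {X} nc = Reach-least (λ _ → id)
    λ e → ≡.subst T (All.lookup nc e) , ≡.subst T (≡.sym (All.lookup nc e))

  insert⁺ : ∀ (X : Fin n → Bool) b → T (insert b X b)
  insert⁺ X b = from T-∨ (inj₁ (does⁺ (b ≟ b) ≡.refl))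

  -- Once a lies in X, an edge ab acts exactly like putting b into X.
  Reach-cons⇒insert : ∀ {X S a b e} → e ≡ (a , b) ⊎ e ≡ (b , a) → T (X a) →
    ∀ {v} → Reach X (e ∷ S) v → Reach (insert b X) S v
  Reach-cons⇒insert {X} o Xa (root x) = root (from T-∨ (inj₂ x))
  Reach-cons⇒insert {X} (inj₁ ≡.refl) Xa (forward  (here ≡.refl) r) = root (insert⁺ X _)
  Reach-cons⇒insert {X} (inj₂ ≡.refl) Xa (forward  (here ≡.refl) r) = root (from T-∨ (inj₂ Xa))
  Reach-cons⇒insert {X} (inj₁ ≡.refl) Xa (backward (here ≡.refl) r) = root (from T-∨ (inj₂ Xa))
  Reach-cons⇒insert {X} (inj₂ ≡.refl) Xa (backward (here ≡.refl) r) = root (insert⁺ X _)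
  Reach-cons⇒insert {X} o Xa (forward  (there e) r) = forward e (Reach-cons⇒insert o Xa r)
  Reach-cons⇒insert {X} o Xa (backward (there e) r) = backward e (Reach-cons⇒insert o Xa r)

  insert⇒Reach-cons : ∀ {X S a b e} → e ≡ (a , b) ⊎ e ≡ (b , a) → T (X a) →
    ∀ {v} → Reach (insert b X) S v → Reach X (e ∷ S) v
  insert⇒Reach-cons {X} {b = b} o Xa (root {v} x) with v ≟ b
  ... | no _       = root x
  ... | yes ≡.refl with o
  ...   | inj₁ ≡.refl = forward (here ≡.refl) (root Xa)
  ...   | inj₂ ≡.refl = backward (here ≡.refl) (root Xa)
  insert⇒Reach-cons o Xa (forward  e r) = forward (there e) (insert⇒Reach-cons o Xa r)
  insert⇒Reach-cons o Xa (backward e r) = backward (there e) (insert⇒Reach-cons o Xa r)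

  spans-cons : ∀ {X S a b e} → e ≡ (a , b) ⊎ e ≡ (b , a) → T (X a) → spans X (e ∷ S) ≡ spans (insert b X) S
  spans-cons {X} {S} {a} {b} {e} o Xa = T-ext
    (λ p → spans⁺ (insert b X) S (Reach-cons⇒insert o Xa ∘ spans⁻ X (e ∷ S) p))
    (λ p → spans⁺ X (e ∷ S) (insert⇒Reach-cons o Xa ∘ spans⁻ (insert b X) S p))

  -- Each edge is listed in one orientation only, so the end inside `X` may be either component. The
  -- permutation brings the crossing edge to the front of the list.
  data CrossingView (X : Fin n → Bool) (S : List Edge) : Set where
    crossing : ∀ e S′ a b → e ≡ (a , b) ⊎ e ≡ (b , a) → X a ≡ true → X b ≡ false →
      S ↭ e ∷ S′ → CrossingView X S
    noncrossing : All (Noncrossing X) S → CrossingView X S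

  crossingView-cons : ∀ {X e S} → Noncrossing X e → CrossingView X S → CrossingView X (e ∷ S)
  crossingView-cons {e = e} eq (crossing f S′ a b o Xa Xb S↭) =
    crossing f (e ∷ S′) a b o Xa Xb (↭-trans (prep e S↭) (swap e f ↭-refl))
  crossingView-cons eq (noncrossing nc) = noncrossing (eq ∷ nc)

  crossingView : ∀ X S → CrossingView X S
  crossingView X [] = noncrossing []
  crossingView X ((a , b) ∷ S) with X a in Xa | X b in Xb
  ... | true  | false = crossing (a , b) S a b (inj₁ ≡.refl) Xa Xb ↭-refl
  ... | false | true  = crossing (a , b) S b a (inj₂ ≡.refl) Xb Xa ↭-refl
  ... | true  | true  = crossingView-cons (≡.trans Xa (≡.sym Xb)) (crossingView X S)
  ... | false | false = crossingView-cons (≡.trans Xa (≡.sym Xb)) (crossingView X S)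

-- Laplacian determinants with unit rows as sums over rooted forests

module MatrixForest {c ℓ} (R : CommutativeRing c ℓ) {n : ℕ} (w : Fin n → Fin n → CommutativeRing.Carrier R) where
  open CommutativeRing R hiding (zero)
  open Algebra.Properties.Ring ring using (-1*x≈-x)
  open Relation.Binary.Reasoning.Setoid setoid
  open IntegerSolver R using (solve; _:=_; _:+_; _:*_; _:-_; :-_; con)
  open Sums R
  open Determinants R
  open UnitRows R
  open Reachability {n}

  weight : List Edge → Carrier
  weight []            = 1#
  weight ((a , b) ∷ S) = w a b * weight S

  incidence : Edge → Fin n → Carrier
  incidence (a , b) i = 𝟙 a i - 𝟙 b i

  -- As a sum of rank-one matrices w v vᵀ, one for each edge with its incidence vector v, the
  -- Laplacian changes by rank one when an edge is removed, and the sign of v does not matter.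
  laplacian : List Edge → Matrix n
  laplacian []            i j = 0#
  laplacian ((a , b) ∷ S) i j = w a b * (incidence (a , b) i * incidence (a , b) j) + laplacian S i j

  ∑⊆ : (List Edge → Carrier) → List Edge → Carrier
  ∑⊆ g []      = g []
  ∑⊆ g (e ∷ S) = ∑⊆ g S + ∑⊆ (g ∘ (e ∷_)) S

  weight-↭ : ∀ {S S′} → S ↭ S′ → weight S ≈ weight S′
  weight-↭ ↭.refl        = refl
  weight-↭ (prep e p)    = *-congˡ (weight-↭ p)
  weight-↭ (swap e f p)  = trans (solve 3 (λ x y z → x :* (y :* z) := y :* (x :* z)) refl _ _ _)
    (*-congˡ (*-congˡ (weight-↭ p)))
  weight-↭ (↭.trans p q) = trans (weight-↭ p) (weight-↭ q)

  laplacian-↭ : ∀ {S S′} → S ↭ S′ → ∀ i j → laplacian S i j ≈ laplacian S′ i j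
  laplacian-↭ ↭.refl        i j = refl
  laplacian-↭ (prep e p)    i j = +-congˡ (laplacian-↭ p i j)
  laplacian-↭ (swap e f p)  i j = trans (solve 3 (λ x y z → x :+ (y :+ z) := y :+ (x :+ z)) refl _ _ _)
    (+-congˡ (+-congˡ (laplacian-↭ p i j)))
  laplacian-↭ (↭.trans p q) i j = trans (laplacian-↭ p i j) (laplacian-↭ q i j)

  ∑⊆-cong : ∀ {g h} → (∀ S → g S ≈ h S) → ∀ S → ∑⊆ g S ≈ ∑⊆ h S
  ∑⊆-cong eq []      = eq []
  ∑⊆-cong eq (e ∷ S) = +-cong (∑⊆-cong eq S) (∑⊆-cong (eq ∘ (e ∷_)) S)

  ∑⊆-zero : ∀ {p} {P : Edge → Set p} {g} → (∀ S → All P S → g S ≈ 0#) → ∀ {S} → All P S → ∑⊆ g S ≈ 0#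
  ∑⊆-zero eq []       = eq [] []
  ∑⊆-zero eq (p ∷ ps) = trans
    (+-cong (∑⊆-zero eq ps) (∑⊆-zero (λ S qs → eq _ (p ∷ qs)) ps)) (+-identityˡ 0#)

  ∑⊆-[] : ∀ {g} → (∀ e S → g (e ∷ S) ≈ 0#) → ∀ S → ∑⊆ g S ≈ g []
  ∑⊆-[] eq []      = refl
  ∑⊆-[] eq (e ∷ S) = trans (+-cong (∑⊆-[] eq S) (trans (∑⊆-[] (λ f S′ → eq e (f ∷ S′)) S) (eq e [])))
    (+-identityʳ _)

  ∑⊆-*ˡ : ∀ x g S → ∑⊆ (λ S → x * g S) S ≈ x * ∑⊆ g S
  ∑⊆-*ˡ x g []      = refl
  ∑⊆-*ˡ x g (e ∷ S) = trans (+-cong (∑⊆-*ˡ x g S) (∑⊆-*ˡ x (g ∘ (e ∷_)) S)) (sym (distribˡ x _ _))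

  -- A crossing edge can stand anywhere in the list and has to be moved to the front. For a
  -- transposition, the subsets are sorted by which of the two edges they contain.
  ∑⊆-↭ : ∀ {g} → (∀ {S S′} → S ↭ S′ → g S ≈ g S′) → ∀ {S S′} → S ↭ S′ → ∑⊆ g S ≈ ∑⊆ g S′
  ∑⊆-↭ inv ↭.refl        = refl
  ∑⊆-↭ inv (prep e p)    = +-cong (∑⊆-↭ inv p) (∑⊆-↭ (inv ∘ prep e) p)
  ∑⊆-↭ inv (↭.trans p q) = trans (∑⊆-↭ inv p) (∑⊆-↭ inv q)
  ∑⊆-↭ {g} inv {e ∷ f ∷ S} {_ ∷ _ ∷ S′} (swap e f p) = begin
    (∑⊆ g S + ∑⊆ (g ∘ (f ∷_)) S) + (∑⊆ (g ∘ (e ∷_)) S + ∑⊆ (g ∘ (e ∷_) ∘ (f ∷_)) S)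
      ≈⟨ +-cong (+-cong (∑⊆-↭ inv p) (∑⊆-↭ (inv ∘ prep f) p))
           (+-cong (∑⊆-↭ (inv ∘ prep e) p)
             (trans (∑⊆-↭ (inv ∘ prep e ∘ prep f) p) (∑⊆-cong (λ _ → inv (swap e f ↭-refl)) S′))) ⟩
    (∑⊆ g S′ + ∑⊆ (g ∘ (f ∷_)) S′) + (∑⊆ (g ∘ (e ∷_)) S′ + ∑⊆ (g ∘ (f ∷_) ∘ (e ∷_)) S′)
      ≈⟨ solve 4 (λ a b c d → (a :+ b) :+ (c :+ d) := (a :+ c) :+ (b :+ d)) refl _ _ _ _ ⟩
    (∑⊆ g S′ + ∑⊆ (g ∘ (e ∷_)) S′) + (∑⊆ (g ∘ (f ∷_)) S′ + ∑⊆ (g ∘ (f ∷_) ∘ (e ∷_)) S′) ∎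

  ∑-𝟙 : ∀ (a : Fin n) (z : Fin n → Carrier) → ∑ (λ i → z i * 𝟙 a i) ≈ z a
  ∑-𝟙 a z = trans (∑-single a _ (λ i i≢a → trans (*-congˡ (𝟙-off (i≢a ∘ ≡.sym))) (zeroʳ _)))
    (trans (*-congˡ (𝟙-diag a)) (*-identityʳ _))

  ∑-incidence : ∀ a b (z : Fin n → Carrier) → ∑ (λ i → z i * incidence (a , b) i) ≈ z a - z b
  ∑-incidence a b z = begin
    ∑ (λ i → z i * (𝟙 a i - 𝟙 b i))
      ≈⟨ ∑-cong (λ i → solve 3 (λ z x y → z :* (x :- y) := z :* x :+ :- con (ℤ.+ 1) :* (z :* y)) refl (z i) (𝟙 a i) (𝟙 b i)) ⟩
    ∑ (λ i → z i * 𝟙 a i + - 1# * (z i * 𝟙 b i)) ≈⟨ ∑-+ _ _ ⟩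
    ∑ (λ i → z i * 𝟙 a i) + ∑ (λ i → - 1# * (z i * 𝟙 b i)) ≈⟨ +-cong (∑-𝟙 a z) (trans (∑-*ˡ _ _) (*-congˡ (∑-𝟙 b z))) ⟩
    z a + - 1# * z b ≈⟨ +-congˡ (-1*x≈-x _) ⟩
    z a - z b ∎

  outside : (Fin n → Bool) → Fin n → Carrier
  outside X i = if X i then 0# else 1#

  -- Pairing the indicator z of the complement with the incidence vector of an edge ab gives z a - z
  -- b, which is 0 when both ends lie on the same side of `X`.
  laplacian-kernel : ∀ X {S} → All (Noncrossing X) S → ∀ j → ∑ (λ i → outside X i * laplacian S i j) ≈ 0#
  laplacian-kernel X []                      j = ∑-zero (λ i → zeroʳ _)
  laplacian-kernel X {(a , b) ∷ S} (eq ∷ nc) j = begin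
    ∑ (λ i → z i * (w a b * (v i * v j) + laplacian S i j))
      ≈⟨ ∑-cong (λ i → solve 5 (λ z w v u l → z :* (w :* (v :* u) :+ l) := (w :* u) :* (z :* v) :+ z :* l) refl
           (z i) (w a b) (v i) (v j) (laplacian S i j)) ⟩
    ∑ (λ i → (w a b * v j) * (z i * v i) + z i * laplacian S i j) ≈⟨ ∑-+ _ _ ⟩
    ∑ (λ i → (w a b * v j) * (z i * v i)) + ∑ (λ i → z i * laplacian S i j)
      ≈⟨ +-cong (∑-*ˡ _ _) (laplacian-kernel X nc j) ⟩
    (w a b * v j) * ∑ (λ i → z i * v i) + 0#
      ≈⟨ trans (+-identityʳ _) (*-congˡ (∑-incidence a b z)) ⟩
    (w a b * v j) * (z a - z b)
      ≈⟨ *-congˡ (trans (+-congʳ (reflexive (Boolₚ.if-cong eq))) (-‿inverseʳ _)) ⟩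
    (w a b * v j) * 0#
      ≈⟨ zeroʳ _ ⟩
    0# ∎
    where
    z = outside X
    v = incidence (a , b)

  -- The kernel vector vanishes on the rows in `X`, so it does not notice that they were replaced;
  -- the vertex `v` outside `X` supplies the coefficient 1 for `det-dependent`.
  det-noncrossing : ∀ X {S} → All (Noncrossing X) S → ∀ v → X v ≡ false →
    det (unitRows X (laplacian S)) ≈ 0#
  det-noncrossing X {S} nc v Xv = det-dependent _ (outside X) v (reflexive (Boolₚ.if-cong Xv))
    (λ j → trans (∑-cong (λ i → ignored i j)) (laplacian-kernel X nc j))
    where
    ignored : ∀ i j → outside X i * unitRows X (laplacian S) i j ≈ outside X i * laplacian S i j
    ignored i j with X i
    ... | true  = trans (zeroˡ _) (sym (zeroˡ _))
    ... | false = refl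

  -- This is the case of empty `X`. The vertex argument excludes the empty matrix, whose determinant
  -- is 1.
  det-laplacian : ∀ S → Fin n → det (laplacian S) ≈ 0#
  det-laplacian S v = det-noncrossing (λ _ → false) (All.tabulate {xs = S} λ _ → ≡.refl) v ≡.refl

  -- The incidence vector is supported on a and b, and row a is already a unit row, so only row b
  -- changes: it gains x times 𝟙 b - 𝟙 a. The part with 𝟙 b is the unit row for `insert b X`; the
  -- part with 𝟙 a repeats row a and contributes 0.
  det-rank-one : ∀ X a b x M → X a ≡ true → X b ≡ false →
    det (unitRows X (λ i j → x * (incidence (a , b) i * incidence (a , b) j) + M i j)) ≈
    det (unitRows X M) + x * det (unitRows (insert b X) M)
  det-rank-one X a b x M Xa Xb = begin
    det (unitRows X (λ i j → x * (v i * v j) + M i j))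
      ≈⟨ det-row-linear b x off-A off-row row-b ⟩
    det A + x * det (A[b≔ r ])
      ≈⟨ +-congˡ (*-congˡ (det-row-linear b (- 1#) off-B off-row₂ row-b₂)) ⟩
    det A + x * (det (unitRows (insert b X) M) + - 1# * det (A[b≔ 𝟙 a ]))
      ≈⟨ +-congˡ (*-congˡ (trans (+-congˡ (trans (*-congˡ repeated) (zeroʳ _))) (+-identityʳ _))) ⟩
    det A + x * det (unitRows (insert b X) M) ∎
    where
    v = incidence (a , b)
    A = unitRows X M
    A′ = unitRows X (λ i j → x * (v i * v j) + M i j)
    r = λ j → 𝟙 b j - 𝟙 a j

    A[b≔_] : (Fin n → Carrier) → Matrix n
    A[b≔ r ] i j = if does (i ≟ b) then r j else A i j

    a≢b : a ≢ b
    a≢b ≡.refl with () ← ≡.trans (≡.sym Xa) Xb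

    at-b : ∀ r j → A[b≔ r ] b j ≈ r j
    at-b r j = reflexive (Boolₚ.if-cong (dec-true (b ≟ b) ≡.refl))

    off-b : ∀ r i j → i ≢ b → A[b≔ r ] i j ≈ A i j
    off-b r i j i≢b = reflexive (Boolₚ.if-cong (dec-false (i ≟ b) i≢b))

    off-A : ∀ i j → i ≢ b → A i j ≈ A′ i j
    off-A i j i≢b with X i in Xi
    ... | true  = refl
    ... | false = sym (begin
      x * (v i * v j) + M i j ≈⟨ +-congʳ (*-congˡ (*-congʳ (+-cong (𝟙-off a≢i) (-‿cong (𝟙-off (i≢b ∘ ≡.sym)))))) ⟩
      x * ((0# - 0#) * v j) + M i j
        ≈⟨ solve 3 (λ x y m → x :* ((con (ℤ.+ 0) :- con (ℤ.+ 0)) :* y) :+ m := m) refl x (v j) (M i j) ⟩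
      M i j ∎)
      where
      a≢i : a ≢ i
      a≢i ≡.refl with () ← ≡.trans (≡.sym Xa) Xi

    off-row : ∀ i j → i ≢ b → A[b≔ r ] i j ≈ A′ i j
    off-row i j i≢b = trans (off-b r i j i≢b) (off-A i j i≢b)

    row-b : ∀ j → A′ b j ≈ A b j + x * A[b≔ r ] b j
    row-b j = begin
      A′ b j ≡⟨ Boolₚ.if-cong Xb ⟩
      x * (v b * v j) + M b j ≈⟨ +-congʳ (*-congˡ (*-congʳ (+-cong (𝟙-off a≢b) (-‿cong (𝟙-diag b))))) ⟩
      x * ((0# - 1#) * (𝟙 a j - 𝟙 b j)) + M b j
        ≈⟨ solve 4 (λ x p q m → x :* ((con (ℤ.+ 0) :- con (ℤ.+ 1)) :* (p :- q)) :+ m := m :+ x :* (q :- p)) refl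
             x (𝟙 a j) (𝟙 b j) (M b j) ⟩
      M b j + x * (𝟙 b j - 𝟙 a j) ≈⟨ +-cong (reflexive (Boolₚ.if-cong Xb)) (*-congˡ (at-b r j)) ⟨
      A b j + x * A[b≔ r ] b j ∎

    off-B : ∀ i j → i ≢ b → unitRows (insert b X) M i j ≈ A[b≔ r ] i j
    off-B i j i≢b = trans (reflexive (Boolₚ.if-cong (≡.cong (_∨ X i) (dec-false (i ≟ b) i≢b)))) (sym (off-b r i j i≢b))

    off-row₂ : ∀ i j → i ≢ b → A[b≔ 𝟙 a ] i j ≈ A[b≔ r ] i j
    off-row₂ i j i≢b = trans (off-b (𝟙 a) i j i≢b) (sym (off-b r i j i≢b))

    row-b₂ : ∀ j → A[b≔ r ] b j ≈ unitRows (insert b X) M b j + - 1# * A[b≔ 𝟙 a ] b j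
    row-b₂ j = begin
      A[b≔ r ] b j ≈⟨ at-b r j ⟩
      𝟙 b j - 𝟙 a j ≈⟨ +-congˡ (-1*x≈-x _) ⟨
      𝟙 b j + - 1# * 𝟙 a j
        ≈⟨ +-cong (reflexive (Boolₚ.if-cong (≡.cong (_∨ X b) (dec-true (b ≟ b) ≡.refl)))) (*-congˡ (at-b (𝟙 a) j)) ⟨
      unitRows (insert b X) M b j + - 1# * A[b≔ 𝟙 a ] b j ∎

    repeated : det A[b≔ 𝟙 a ] ≈ 0#
    repeated = det-alternating _ a≢b λ j →
      trans (off-b (𝟙 a) a j a≢b) (trans (reflexive (Boolₚ.if-cong Xa)) (sym (at-b (𝟙 a) j)))

  -- For `k = misses X`, having n - |X| edges and reaching every vertex from `X` forces a forest
  -- with exactly one vertex of `X` in each tree, so no test for cycles is needed.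
  forestTerm : (Fin n → Bool) → ℕ → List Edge → Carrier
  forestTerm X k S = if (length S ≡ᵇ k) ∧ spans X S then weight S else 0#

  forestTerm-↭ : ∀ X k {S S′} → S ↭ S′ → forestTerm X k S ≈ forestTerm X k S′
  forestTerm-↭ X k {S} {S′} p = trans
    (reflexive (Boolₚ.if-cong (≡.cong₂ (λ m s → (m ≡ᵇ k) ∧ s) (↭-length p)
      (T-ext (spans-mono X (∈-resp-↭ p)) (spans-mono X (∈-resp-↭ (↭-sym p)))))))
    (if-congˡ ((length S′ ≡ᵇ k) ∧ spans X S′))
    where
    if-congˡ : ∀ b → (if b then weight S else 0#) ≈ (if b then weight S′ else 0#)
    if-congˡ true  = weight-↭ p
    if-congˡ false = refl

  forestTerm-cons : ∀ {X a b e} k → e ≡ (a , b) ⊎ e ≡ (b , a) → T (X a) → ∀ S →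
    forestTerm X (suc k) (e ∷ S) ≈ w (proj₁ e) (proj₂ e) * forestTerm (insert b X) k S
  forestTerm-cons {X} {b = b} {e} k o Xa S rewrite spans-cons {X} {S} o Xa
    with (length S ≡ᵇ k) ∧ spans (insert b X) S
  ... | true  = refl
  ... | false = sym (zeroʳ _)

  laplacian-cons : ∀ {a b e} → e ≡ (a , b) ⊎ e ≡ (b , a) → ∀ S i j →
    laplacian (e ∷ S) i j ≈ w (proj₁ e) (proj₂ e) * (incidence (a , b) i * incidence (a , b) j) + laplacian S i j
  laplacian-cons         (inj₁ ≡.refl) S i j = refl
  laplacian-cons {a} {b} (inj₂ ≡.refl) S i j = +-congʳ (*-congˡ
    (solve 4 (λ p q r s → (p :- q) :* (r :- s) := (q :- p) :* (s :- r)) refl (𝟙 b i) (𝟙 a i) (𝟙 b j) (𝟙 a j)))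

  unitRows-cong : ∀ X {A B : Matrix n} → (∀ i j → A i j ≈ B i j) → ∀ i j → unitRows X A i j ≈ unitRows X B i j
  unitRows-cong X eq i j with X i
  ... | true  = refl
  ... | false = eq i j

  -- Always removing an edge that leaves X gives deletion-contraction without ever contracting.
  forest : ∀ m S X → length S ≡ m → det (unitRows X (laplacian S)) ≈ ∑⊆ (forestTerm X (misses X)) S
  forest m S X len with crossingView X S
  forest m S X len | noncrossing nc with misses X in missed
  -- Every row is now a unit row, and the empty set is the only edge set of size 0.
  ... | zero = begin
    det (unitRows X (laplacian S))
      ≈⟨ det-identity _ (λ i → trans (full i i) (𝟙-diag i)) (λ i j j≢i → trans (full i j) (𝟙-off (j≢i ∘ ≡.sym))) ⟩
    1# ≡⟨ Boolₚ.if-cong (to T-≡ (spans⁺ X [] (λ v → root (from T-≡ (misses≡0 X missed v))))) ⟨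
    forestTerm X 0 [] ≈⟨ ∑⊆-[] (λ e S → refl) S ⟨
    ∑⊆ (forestTerm X 0) S ∎
    where
    full : ∀ i j → unitRows X (laplacian S) i j ≈ 𝟙 i j
    full i j = reflexive (Boolₚ.if-cong (misses≡0 X missed i))
  -- No edge leaves `X`, so `v` is reached by no edge subset and every term of the sum is 0.
  ... | suc k with v , Xv ← misses-positive X missed = trans (det-noncrossing X nc v Xv)
    (sym (∑⊆-zero (λ S′ nc′ → reflexive (Boolₚ.if-cong (≡.trans (≡.cong ((length S′ ≡ᵇ suc k) ∧_)
        (Boolₚ.¬-not (λ sp → ≡.subst T Xv (noncrossing-Reach nc′ (spans⁻ X S′ (from T-≡ sp) v)))))
        (Boolₚ.∧-zeroʳ (length S′ ≡ᵇ suc k))))) nc))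
  -- The recursion is on the length because `S′` arises through a permutation and is not a
  -- structural part of `S`.
  forest zero    S X len | crossing e S′ a b o Xa Xb p with () ← ≡.trans (≡.sym len) (↭-length p)
  forest (suc m) S X len | crossing e S′ a b o Xa Xb p = begin
    det (unitRows X (laplacian S))
      ≈⟨ det-cong (unitRows-cong X (λ i j → trans (laplacian-↭ p i j) (laplacian-cons o S′ i j))) ⟩
    det (unitRows X (λ i j → wₑ * (incidence (a , b) i * incidence (a , b) j) + laplacian S′ i j))
      ≈⟨ det-rank-one X a b wₑ (laplacian S′) Xa Xb ⟩
    det (unitRows X (laplacian S′)) + wₑ * det (unitRows (insert b X) (laplacian S′))
      ≈⟨ +-cong (forest m S′ X len′) (*-congˡ (forest m S′ (insert b X) len′)) ⟩
    ∑⊆ (forestTerm X (misses X)) S′ + wₑ * ∑⊆ (forestTerm (insert b X) k) S′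
      ≈⟨ +-congˡ (∑⊆-*ˡ wₑ _ S′) ⟨
    ∑⊆ (forestTerm X (misses X)) S′ + ∑⊆ (λ S → wₑ * forestTerm (insert b X) k S) S′
      ≈⟨ +-congˡ (∑⊆-cong (λ S → trans (reflexive (≡.cong (λ k → forestTerm X k (e ∷ S)) (misses-insert X b Xb)))
           (forestTerm-cons k o (from T-≡ Xa) S)) S′) ⟨
    ∑⊆ (forestTerm X (misses X)) (e ∷ S′)
      ≈⟨ ∑⊆-↭ (forestTerm-↭ X (misses X)) p ⟨
    ∑⊆ (forestTerm X (misses X)) S ∎
    where
    k  = misses (insert b X)
    wₑ = w (proj₁ e) (proj₂ e)
    len′ : length S′ ≡ m
    len′ = ℕₚ.suc-injective (≡.trans (≡.sym (↭-length p)) len)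

-- Sums over lists and over pairs p < q

module ListSums {c ℓ} (R : CommutativeRing c ℓ) where
  open CommutativeRing R hiding (zero)
  open RingOps rawRing using (sumL)
  open Sums R
  open UnitRows R
  open Relation.Binary.Reasoning.Setoid setoid

  sumL-++ : ∀ xs ys → sumL (xs ++ ys) ≈ sumL xs + sumL ys
  sumL-++ []       ys = sym (+-identityˡ _)
  sumL-++ (x ∷ xs) ys = trans (+-congˡ (sumL-++ xs ys)) (sym (+-assoc _ _ _))

  sumL-filter : ∀ {a} {A : Set a} (P : A → Bool) (g : A → Carrier) xs →
    sumL (map g (filter (λ x → T? (P x)) xs)) ≈ sumL (map (λ x → if P x then g x else 0#) xs)
  sumL-filter P g []       = refl
  sumL-filter P g (x ∷ xs) with P x
  ... | true  = +-congˡ (sumL-filter P g xs)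
  ... | false = trans (sumL-filter P g xs) (sym (+-identityˡ _))

  sumL-tabulate : ∀ {a} {A : Set a} {n} (g : A → Carrier) (f : Fin n → A) →
    sumL (map g (tabulate f)) ≈ ∑ (λ i → g (f i))
  sumL-tabulate {n = zero}  g f = reflexive (≡.sym ∑-nil)
  sumL-tabulate {n = suc n} g f = trans (+-congˡ (sumL-tabulate g (f ∘ suc))) (reflexive (≡.sym (∑-cons _)))

  sumL-concatMap : ∀ {a b} {A : Set a} {B : Set b} (g : B → Carrier) (F : A → List B) xs →
    sumL (map g (concatMap F xs)) ≈ sumL (map (λ x → sumL (map g (F x))) xs)
  sumL-concatMap g F []       = refl
  sumL-concatMap g F (x ∷ xs) = trans (reflexive (≡.cong sumL (Listₚ.map-++ g (F x) (concatMap F xs))))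
    (trans (sumL-++ (map g (F x)) _) (+-congˡ (sumL-concatMap g F xs)))

  ∑<-cong : ∀ {n} {f g : Fin n → Fin n → Carrier} → 
    (∀ p q → (toℕ p <ᵇ toℕ q) ≡ true → f p q ≈ g p q) → ∑< f ≈ ∑< g
  ∑<-cong {f = f} {g} eq = ∑-cong λ p → ∑-cong λ q → cases p q
    where
    cases : ∀ p q → (if toℕ p <ᵇ toℕ q then f p q else 0#) ≈ (if toℕ p <ᵇ toℕ q then g p q else 0#)
    cases p q with toℕ p <ᵇ toℕ q in p<q
    ... | true  = eq p q p<q
    ... | false = refl

  ∑<-*ˡ : ∀ {n} x (f : Fin n → Fin n → Carrier) → ∑< (λ p q → x * f p q) ≈ x * ∑< f
  ∑<-*ˡ x f = trans (∑-cong λ p → trans (∑-cong λ q → cases (toℕ p <ᵇ toℕ q) (f p q)) (∑-*ˡ x _)) (∑-*ˡ x _)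
    where
    cases : ∀ b z → (if b then x * z else 0#) ≈ x * (if b then z else 0#)
    cases true  z = refl
    cases false z = sym (zeroʳ x)

  -- Degrees and matrix entries are sums over arcs, whereas the edge list has each edge once; this
  -- passes between the two.
  ∑-symmetrize : ∀ {n} (f : Fin n → Fin n → Carrier) → (∀ p → f p p ≈ 0#) →
    ∑ (λ p → ∑ (f p)) ≈ ∑< (λ p q → f p q + f q p)
  ∑-symmetrize {zero}  f diag = trans (reflexive ∑-nil) (reflexive (≡.sym ∑-nil))
  ∑-symmetrize {suc n} f diag = begin
    ∑ (λ p → ∑ (f p))
      ≡⟨ ∑-cons _ ⟩
    ∑ (f zero) + ∑ (λ p → ∑ (f (suc p)))
      ≈⟨ +-cong (trans (reflexive (∑-cons _)) (trans (+-congʳ (diag zero)) (+-identityˡ _)))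
           (trans (∑-cong (λ p → reflexive (∑-cons _))) (∑-+ _ _)) ⟩
    ∑ (λ q → f zero (suc q)) + (∑ (λ p → f (suc p) zero) + ∑ (λ p → ∑ (λ q → f (suc p) (suc q))))
      ≈⟨ trans (sym (+-assoc _ _ _)) (+-cong (sym (∑-+ _ _)) (∑-symmetrize (λ p q → f (suc p) (suc q)) (diag ∘ suc))) ⟩
    ∑ (λ q → f zero (suc q) + f (suc q) zero) + ∑< (λ p q → f (suc p) (suc q) + f (suc q) (suc p))
      ≈⟨ ∑<-cons _ ⟨
    ∑< (λ p q → f p q + f q p) ∎

-- The graph Laplacian as a sum over the edge list

module GraphLaplacian {c ℓ} (R : CommutativeRing c ℓ) {n : ℕ}
    (adj : Fin n → Fin n → Bool) (w : Fin n → Fin n → CommutativeRing.Carrier R)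
    (adj-sym : ∀ i j → adj i j ≡ adj j i) (adj-irrefl : ∀ i → adj i i ≡ false)
    (w-sym : ∀ i j → adj i j ≡ true → CommutativeRing._≈_ R (w i j) (w j i)) where
  open CommutativeRing R hiding (zero)
  open Algebra.Properties.Ring ring using (-1*x≈-x)
  open Relation.Binary.Reasoning.Setoid setoid
  open IntegerSolver R using (solve; _:=_; _:+_; _:*_; _:-_; :-_; con)
  open Weighted R adj w hiding (det)
  open Sums R
  open Determinants R
  open UnitRows R
  open ListSums R
  open Reachability {n}
  open MatrixForest R w

  δ≡𝟙 : ∀ i j → δ i j ≡ 𝟙 i j
  δ≡𝟙 i j = Boolₚ.if-cong (≡ᵇ≡does i j)

  Wm-irrefl : ∀ i → Wm i i ≈ 0#
  Wm-irrefl i = reflexive (Boolₚ.if-cong (adj-irrefl i))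

  Wm-sym : ∀ i j → Wm i j ≈ Wm j i
  Wm-sym i j with adj i j in ij | adj j i in ji
  ... | true  | true  = w-sym i j ij
  ... | false | false = refl
  ... | true  | false with () ← ≡.trans (≡.sym ij) (≡.trans (adj-sym i j) ji)
  ... | false | true  with () ← ≡.trans (≡.sym ij) (≡.trans (adj-sym i j) ji)

  dw≈∑ : ∀ i → dw i ≈ ∑ (Wm i)
  dw≈∑ i = reflexive (≡.sym (∑≡sumF _))

  edge-sum : ∀ (g : Edge → Carrier) → sumL (map g edges) ≈
    ∑ (λ i → ∑ (λ j → if adj i j ∧ (toℕ i <ᵇ toℕ j) then g (i , j) else 0#))
  edge-sum g = begin
    sumL (map g edges)
      ≈⟨ sumL-concatMap g _ (allFin n) ⟩
    sumL (map (λ i → sumL (map g (map (i ,_) (filter (λ j → T? (adj i j ∧ (toℕ i <ᵇ toℕ j))) (allFin n))))) (allFin n))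
      ≈⟨ sumL-tabulate _ id ⟩
    ∑ (λ i → sumL (map g (map (i ,_) (filter (λ j → T? (adj i j ∧ (toℕ i <ᵇ toℕ j))) (allFin n)))))
      ≈⟨ ∑-cong (λ i → trans (reflexive (≡.cong sumL (≡.sym (Listₚ.map-∘ {g = g} {f = i ,_} (filter (λ j → T? (adj i j ∧ (toℕ i <ᵇ toℕ j))) (allFin n))))))
           (trans (sumL-filter _ (λ j → g (i , j)) (allFin n)) (sumL-tabulate _ id))) ⟩
    ∑ (λ i → ∑ (λ j → if adj i j ∧ (toℕ i <ᵇ toℕ j) then g (i , j) else 0#)) ∎

  weighted-edge-sum : ∀ (g : Edge → Carrier) (h : Fin n → Fin n → Carrier) → (∀ i j → g (i , j) ≈ w i j * h i j) →
    sumL (map g edges) ≈ ∑< (λ i j → Wm i j * h i j)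
  weighted-edge-sum g h eq = trans (edge-sum g) (∑-cong λ i → ∑-cong λ j → cases i j)
    where
    cases : ∀ i j → (if adj i j ∧ (toℕ i <ᵇ toℕ j) then g (i , j) else 0#) ≈
                    (if toℕ i <ᵇ toℕ j then Wm i j * h i j else 0#)
    cases i j with adj i j | toℕ i <ᵇ toℕ j
    ... | true  | true  = eq i j
    ... | true  | false = refl
    ... | false | true  = sym (zeroˡ _)
    ... | false | false = refl

  ∑-dw : ∑ dw ≈ two * wG
  ∑-dw = begin
    ∑ dw ≈⟨ ∑-cong dw≈∑ ⟩
    ∑ (λ i → ∑ (Wm i)) ≈⟨ ∑-symmetrize Wm Wm-irrefl ⟩
    ∑< (λ i j → Wm i j + Wm j i)
      ≈⟨ ∑<-cong (λ i j _ → trans (+-congˡ (Wm-sym j i))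
           (solve 1 (λ x → x :+ x := x :* (con (ℤ.+ 1) :+ con (ℤ.+ 1))) refl (Wm i j))) ⟩
    ∑< (λ i j → Wm i j * two)
      ≈⟨ weighted-edge-sum (λ { (i , j) → w i j * two }) (λ _ _ → two) (λ i j → refl) ⟨
    sumL (map (λ { (i , j) → w i j * two }) edges) ≈⟨ double edges ⟩
    two * wG ∎
    where
    double : ∀ S → sumL (map (λ { (i , j) → w i j * two }) S) ≈ two * sumL (map (λ { (i , j) → w i j }) S)
    double []            = sym (zeroʳ two)
    double ((i , j) ∷ S) = trans (+-cong (*-comm _ _) (double S)) (sym (distribˡ two _ _))

  -- Splitting the first factor of the rank-one term into its 𝟙 a and 𝟙 b parts gives two summands
  -- exchanged by reversing the edge, since the weight is symmetric. The edge sum thus becomes a sum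
  -- over arcs, in which 𝟙 a i selects a = i.
  laplacian-edges : ∀ i j → laplacian edges i j ≈ Lap i j
  laplacian-edges i j = begin
    laplacian edges i j ≡⟨ as-sum edges ⟩
    sumL (map entry edges)
      ≈⟨ weighted-edge-sum entry (λ a b → incidence (a , b) i * incidence (a , b) j) (λ a b → refl) ⟩
    ∑< (λ a b → Wm a b * (incidence (a , b) i * incidence (a , b) j))
      ≈⟨ ∑<-cong (λ a b _ → trans
           (solve 5 (λ x p q r s → x :* ((p :- q) :* (r :- s)) := x :* (p :* (r :- s)) :+ x :* (q :* (s :- r))) refl
             (Wm a b) (𝟙 a i) (𝟙 b i) (𝟙 a j) (𝟙 b j))
           (+-congˡ (*-congʳ (Wm-sym a b)))) ⟩
    ∑< (λ a b → half a b + half b a)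
      ≈⟨ ∑-symmetrize half (λ a → trans (*-congʳ (Wm-irrefl a)) (zeroˡ _)) ⟨
    ∑ (λ a → ∑ (half a))
      ≈⟨ ∑-single i _ (λ a a≢i → ∑-zero (λ b → trans (*-congˡ (trans (*-congʳ (𝟙-off a≢i)) (zeroˡ _))) (zeroʳ _))) ⟩
    ∑ (half i)
      ≈⟨ ∑-cong (λ b → trans (*-congˡ (*-congʳ (𝟙-diag i)))
           (solve 3 (λ x r s → x :* (con (ℤ.+ 1) :* (r :- s)) := r :* x :+ :- con (ℤ.+ 1) :* (x :* s)) refl
             (Wm i b) (𝟙 i j) (𝟙 b j))) ⟩
    ∑ (λ b → 𝟙 i j * Wm i b + - 1# * (Wm i b * 𝟙 b j))
      ≈⟨ trans (∑-+ _ _) (+-cong (∑-*ˡ _ _) (∑-*ˡ _ _)) ⟩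
    𝟙 i j * ∑ (Wm i) + - 1# * ∑ (λ b → Wm i b * 𝟙 b j)
      ≈⟨ +-cong (*-congˡ (sym (dw≈∑ i))) (*-congˡ (trans
           (∑-single j _ (λ b b≢j → trans (*-congˡ (𝟙-off b≢j)) (zeroʳ _)))
           (trans (*-congˡ (𝟙-diag j)) (*-identityʳ _)))) ⟩
    𝟙 i j * dw i + - 1# * Wm i j
      ≈⟨ +-cong diagonal (-1*x≈-x _) ⟩
    Lap i j ∎
    where
    entry : Edge → Carrier
    entry (a , b) = w a b * (incidence (a , b) i * incidence (a , b) j)

    as-sum : ∀ S → laplacian S i j ≡ sumL (map entry S)
    as-sum []      = ≡.refl
    as-sum (e ∷ S) = ≡.cong (entry e +_) (as-sum S)

    half : Fin n → Fin n → Carrier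
    half a b = Wm a b * (𝟙 a i * (𝟙 a j - 𝟙 b j))

    diagonal : 𝟙 i j * dw i ≈ (if eqF i j then dw i else 0#)
    diagonal rewrite ≡ᵇ≡does i j with does (i ≟ j)
    ... | true  = *-identityˡ _
    ... | false = zeroˡ _

  det-Lap : Fin n → det Lap ≈ 0#
  det-Lap v = trans (sym (det-cong laplacian-edges)) (det-laplacian edges v)

  reach≡closure : ∀ S s k v → reach S s k v ≡ closure ⁅ s ⁆ S k v
  reach≡closure S s zero    v = ≡ᵇ≡does v s
  reach≡closure S s (suc k) v = ≡.cong₂ _∨_ (reach≡closure S s k v) (≡.cong or (Listₚ.map-cong
    (λ { (a , b) → ≡.cong₂ _∨_ (≡.cong₂ _∧_ (≡ᵇ≡does a v) (reach≡closure S s k b))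
                               (≡.cong₂ _∧_ (≡ᵇ≡does b v) (reach≡closure S s k a)) }) S))

  -- `connectedB` tests reachability from every source. Since edges are used in both directions, any
  -- two vertices reached from `p` reach each other, so the single source `p` suffices.
  connectedB≡spans : ∀ p S → connectedB S ≡ spans ⁅ p ⁆ S
  connectedB≡spans p S = T-ext
    (λ c → all-allFin⁺ _ λ v → ≡.subst T (reach≡closure S p n v) (all-allFin⁻ _ (all-allFin⁻ _ c p) v))
    (λ c → all-allFin⁺ _ λ s → all-allFin⁺ _ λ v → ≡.subst T (≡.sym (reach≡closure S s n v))
      (closure-complete (Reach-trans (Reach-sym (spans⁻ ⁅ p ⁆ S c s)) (spans⁻ ⁅ p ⁆ S c v))))

  sumL-sublists : ∀ g S → sumL (map g (sublists S)) ≈ ∑⊆ g S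
  sumL-sublists g []      = +-identityʳ _
  sumL-sublists g (e ∷ S) = trans (reflexive (≡.cong sumL (Listₚ.map-++ g (sublists S) _)))
    (trans (sumL-++ (map g (sublists S)) _) (+-cong (sumL-sublists g S)
      (trans (reflexive (≡.cong sumL (≡.sym (Listₚ.map-∘ {g = g} {f = e ∷_} (sublists S))))) (sumL-sublists (g ∘ (e ∷_)) S))))

-- The matrix-tree theorem for principal minors

module MatrixTree {c ℓ} (R : CommutativeRing c ℓ) {m : ℕ}
    (adj : Fin (suc m) → Fin (suc m) → Bool) (w : Fin (suc m) → Fin (suc m) → CommutativeRing.Carrier R)
    (adj-sym : ∀ i j → adj i j ≡ adj j i) (adj-irrefl : ∀ i → adj i i ≡ false)
    (w-sym : ∀ i j → adj i j ≡ true → CommutativeRing._≈_ R (w i j) (w j i)) where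
  open CommutativeRing R hiding (zero)
  open Relation.Binary.Reasoning.Setoid setoid
  open Weighted R adj w hiding (det)
  open Determinants R
  open UnitRows R
  open ListSums R
  open Reachability {suc m}
  open MatrixForest R w
  open GraphLaplacian R adj w adj-sym adj-irrefl w-sym

  det-unitRow-Lap : ∀ p → det (unitRow p Lap) ≈ κw
  det-unitRow-Lap p = begin
    det (unitRow p Lap)               ≈⟨ det-cong (unitRows-cong ⁅ p ⁆ laplacian-edges) ⟨
    det (unitRow p (laplacian edges)) ≈⟨ forest _ edges ⁅ p ⁆ ≡.refl ⟩
    ∑⊆ (forestTerm ⁅ p ⁆ (misses ⁅ p ⁆)) edges
      ≈⟨ ∑⊆-cong (λ S → trans
           (reflexive (Boolₚ.if-cong (≡.cong₂ (λ k s → (length S ≡ᵇ k) ∧ s) (≡.sym (misses-singleton p)) (connectedB≡spans p S))))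
           (reflexive (≡.cong (if (length S ≡ᵇ misses ⁅ p ⁆) ∧ spans ⁅ p ⁆ S then_else 0#) (product S)))) edges ⟨
    ∑⊆ (λ S → if isSpanningTree S then prodL (map (λ { (i , j) → w i j }) S) else 0#) edges
      ≈⟨ sumL-sublists _ edges ⟨
    _ ≈⟨ sumL-filter isSpanningTree _ (sublists edges) ⟨
    κw ∎
    where
    product : ∀ S → prodL (map (λ { (i , j) → w i j }) S) ≡ weight S
    product []            = ≡.refl
    product ((i , j) ∷ S) = ≡.cong (w i j *_) (product S)

-- Dual numbers over a commutative ring

module DualNumbers {c ℓ} (K : CommutativeRing c ℓ) where
  open CommutativeRing K
  open IntegerSolver K using (solve; _:=_; _:+_; _:*_; con)

  componentwise : AbelianGroup c ℓ
  componentwise = DirectProduct.abelianGroup +-abelianGroup +-abelianGroup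

  module + = AbelianGroup componentwise

  _⊛_ : Carrier × Carrier → Carrier × Carrier → Carrier × Carrier
  (x , x′) ⊛ (y , y′) = x * y , x * y′ + x′ * y

  opaque
    -- Opaque, since comparing two rings would otherwise normalise the solver's proofs.
    isCommutativeRing-dual : IsCommutativeRing +._≈_ +._∙_ _⊛_ +._⁻¹ +.ε (1# , 0#)
    isCommutativeRing-dual = record
      { isRing = record
        { +-isAbelianGroup = +.isAbelianGroup
        ; *-cong     = λ (p , p′) (q , q′) → *-cong p q , +-cong (*-cong p q′) (*-cong p′ q)
        ; *-assoc    = λ (x , x′) (y , y′) (z , z′) → *-assoc x y z ,
            solve 6 (λ x x′ y y′ z z′ → (x :* y) :* z′ :+ (x :* y′ :+ x′ :* y) :* z
              := x :* (y :* z′ :+ y′ :* z) :+ x′ :* (y :* z)) refl x x′ y y′ z z′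
        ; *-identity = (λ (x , x′) → *-identityˡ x ,
              solve 2 (λ x x′ → con (ℤ.+ 1) :* x′ :+ con (ℤ.+ 0) :* x := x′) refl x x′)
            , (λ (x , x′) → *-identityʳ x ,
              solve 2 (λ x x′ → x :* con (ℤ.+ 0) :+ x′ :* con (ℤ.+ 1) := x′) refl x x′)
        ; distrib    = (λ (x , x′) (y , y′) (z , z′) → distribˡ x y z ,
              solve 6 (λ x x′ y y′ z z′ → x :* (y′ :+ z′) :+ x′ :* (y :+ z)
                := (x :* y′ :+ x′ :* y) :+ (x :* z′ :+ x′ :* z)) refl x x′ y y′ z z′)
            , (λ (x , x′) (y , y′) (z , z′) → distribʳ x y z ,
              solve 6 (λ x x′ y y′ z z′ → (y :+ z) :* x′ :+ (y′ :+ z′) :* x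
                := (y :* x′ :+ y′ :* x) :+ (z :* x′ :+ z′ :* x)) refl x x′ y y′ z z′)
        }
      ; *-comm = λ (x , x′) (y , y′) → *-comm x y ,
          solve 4 (λ x x′ y y′ → x :* y′ :+ x′ :* y := y :* x′ :+ y′ :* x) refl x x′ y y′
      }

Dual : ∀ {c ℓ} → CommutativeRing c ℓ → CommutativeRing c ℓ
Dual K = record { isCommutativeRing = DualNumbers.isCommutativeRing-dual K }

-- Evaluation of polynomials and the Taylor formula

-- The source is a raw ring because coefficient lists fail the ring laws: p + (-p) is a list of
-- zeros, not the empty list. Only the target needs the laws.
record Hom {a b c ℓ} (C : RawRing a b) (K : CommutativeRing c ℓ) : Set (a ⊔ c ⊔ ℓ) where
  no-eta-equality
  private module C = RawRing C
  open CommutativeRing K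
  field
    ⟦_⟧    : C.Carrier → Carrier
    +-homo : ∀ x y → ⟦ x C.+ y ⟧ ≈ ⟦ x ⟧ + ⟦ y ⟧
    *-homo : ∀ x y → ⟦ x C.* y ⟧ ≈ ⟦ x ⟧ * ⟦ y ⟧
    -‿homo : ∀ x → ⟦ C.- x ⟧ ≈ - ⟦ x ⟧
    0-homo : ⟦ C.0# ⟧ ≈ 0#
    1-homo : ⟦ C.1# ⟧ ≈ 1#

module Homs {a b c ℓ} {C : RawRing a b} {K : CommutativeRing c ℓ} (h : Hom C K) where
  open CommutativeRing K hiding (zero)
  open Algebra.Properties.Ring ring using (-0#≈0#)
  open Relation.Binary.Reasoning.Setoid setoid
  open IntegerSolver K using (solve; _:=_; _:+_; _:*_; :-_; con)
  open Determinants K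
  open Sums K
  open Hom h
  private
    module C = RawRing C
    module C′ = RingOps C
    module K′ = RingOps rawRing
    module P = PolyOps C

  fromℕ-homo : ∀ k → ⟦ C′.fromℕ k ⟧ ≈ K′.fromℕ k
  fromℕ-homo zero    = 0-homo
  fromℕ-homo (suc k) = trans (+-homo _ _) (+-cong 1-homo (fromℕ-homo k))

  sumF-homo : ∀ n f → ⟦ C′.sumF n f ⟧ ≈ ∑ (λ i → ⟦ f i ⟧)
  sumF-homo zero    f = trans 0-homo (reflexive (≡.sym ∑-nil))
  sumF-homo (suc n) f = trans (+-homo _ _) (trans (+-congˡ (sumF-homo n (f ∘ suc))) (reflexive (≡.sym (∑-cons _))))

  sign-homo : ∀ k → ⟦ C′.sign k ⟧ ≈ K′.sign k
  sign-homo zero    = 1-homo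
  sign-homo (suc k) = trans (-‿homo _) (-‿cong (sign-homo k))

  det-homo : ∀ {n} (M : Fin n → Fin n → C.Carrier) → ⟦ C′.det M ⟧ ≈ det (λ i j → ⟦ M i j ⟧)
  det-homo {zero}  M = trans 1-homo (reflexive (≡.sym det-nil))
  det-homo {suc n} M = trans (sumF-homo (suc n) _) (trans
    (∑-cong λ j → trans (*-homo _ _) (*-cong (sign-homo (toℕ j)) (trans (*-homo _ _)
      (*-congˡ (det-homo (λ a b → M (suc a) (punchIn j b)))))))
    (reflexive (≡.sym (det-cons _))))

  eval : Carrier → P.Poly → Carrier
  eval x []      = 0#
  eval x (a ∷ p) = ⟦ a ⟧ + x * eval x p

  eval-+ : ∀ x p q → eval x (P.addP p q) ≈ eval x p + eval x q
  eval-+ x []      q       = sym (+-identityˡ _)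
  eval-+ x (a ∷ p) []      = sym (+-identityʳ _)
  eval-+ x (a ∷ p) (b ∷ q) = trans (+-cong (+-homo a b) (*-congˡ (eval-+ x p q)))
    (solve 5 (λ x a b s t → (a :+ b) :+ x :* (s :+ t) := (a :+ x :* s) :+ (b :+ x :* t)) refl
      x ⟦ a ⟧ ⟦ b ⟧ (eval x p) (eval x q))

  eval-scale : ∀ x a q → eval x (map (a C.*_) q) ≈ ⟦ a ⟧ * eval x q
  eval-scale x a []      = sym (zeroʳ _)
  eval-scale x a (b ∷ q) = trans (+-cong (*-homo a b) (*-congˡ (eval-scale x a q)))
    (solve 4 (λ x a b s → a :* b :+ x :* (a :* s) := a :* (b :+ x :* s)) refl x ⟦ a ⟧ ⟦ b ⟧ (eval x q))

  eval-* : ∀ x p q → eval x (P.mulP p q) ≈ eval x p * eval x q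
  eval-* x []      q = sym (zeroˡ _)
  eval-* x (a ∷ p) q = begin
    eval x (P.addP (map (a C.*_) q) (C.0# ∷ P.mulP p q)) ≈⟨ eval-+ x (map (a C.*_) q) _ ⟩
    eval x (map (a C.*_) q) + (⟦ C.0# ⟧ + x * eval x (P.mulP p q))
      ≈⟨ +-cong (eval-scale x a q) (+-cong 0-homo (*-congˡ (eval-* x p q))) ⟩
    ⟦ a ⟧ * eval x q + (0# + x * (eval x p * eval x q))
      ≈⟨ solve 4 (λ x a s t → a :* t :+ (con (ℤ.+ 0) :+ x :* (s :* t)) := (a :+ x :* s) :* t) refl
           x ⟦ a ⟧ (eval x p) (eval x q) ⟩
    (⟦ a ⟧ + x * eval x p) * eval x q ∎

  eval-neg : ∀ x p → eval x (P.negP p) ≈ - eval x p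
  eval-neg x []      = sym -0#≈0#
  eval-neg x (a ∷ p) = trans (+-cong (-‿homo a) (*-congˡ (eval-neg x p)))
    (solve 3 (λ x a s → :- a :+ x :* :- s := :- (a :+ x :* s)) refl x ⟦ a ⟧ (eval x p))

  eval-const : ∀ x a → eval x (P.constP a) ≈ ⟦ a ⟧
  eval-const x a = trans (+-congˡ (zeroʳ x)) (+-identityʳ _)

  eval-var : ∀ x → eval x P.varP ≈ x
  eval-var x = trans (+-cong 0-homo (*-congˡ (trans (eval-const x C.1#) 1-homo)))
    (solve 1 (λ x → con (ℤ.+ 0) :+ x :* con (ℤ.+ 1) := x) refl x)

  evalHom : Carrier → Hom P.polyRing K
  evalHom x .Hom.⟦_⟧    = eval x
  evalHom x .Hom.+-homo = eval-+ x
  evalHom x .Hom.*-homo = eval-* x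
  evalHom x .Hom.-‿homo = eval-neg x
  evalHom x .Hom.0-homo = refl
  evalHom x .Hom.1-homo = trans (eval-const x C.1#) 1-homo

  eval-derivFrom-suc : ∀ x k p → eval x (P.derivFrom (suc k) p) ≈ eval x p + eval x (P.derivFrom k p)
  eval-derivFrom-suc x k []      = sym (+-identityˡ 0#)
  eval-derivFrom-suc x k (b ∷ p) = trans
    (+-cong (trans (*-homo _ b) (*-congʳ (trans (+-homo _ _) (+-congʳ 1-homo)))) (*-congˡ (eval-derivFrom-suc x (suc k) p)))
    (trans
      (solve 5 (λ x k b s t → (con (ℤ.+ 1) :+ k) :* b :+ x :* (s :+ t) := (b :+ x :* s) :+ (k :* b :+ x :* t)) refl
        x ⟦ C′.fromℕ k ⟧ ⟦ b ⟧ (eval x p) (eval x (P.derivFrom (suc k) p)))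
      (+-congˡ (+-congʳ (sym (*-homo _ b)))))

  eval-derivFrom-zero : ∀ x p → eval x (P.derivFrom 0 p) ≈ x * eval x (P.deriv p)
  eval-derivFrom-zero x []      = sym (zeroʳ x)
  eval-derivFrom-zero x (b ∷ p) = trans
    (+-congʳ (trans (*-homo _ b) (trans (*-congʳ 0-homo) (zeroˡ _)))) (+-identityˡ _)

  -- This is the product rule for a + x p. `deriv` counts exponents upwards instead of recursing
  -- through itself, so the rule is recovered by shifting the starting exponent of `derivFrom`.
  eval-deriv-cons : ∀ x a p → eval x (P.deriv (a ∷ p)) ≈ eval x p + x * eval x (P.deriv p)
  eval-deriv-cons x a p = trans (eval-derivFrom-suc x 0 p) (+-congˡ (eval-derivFrom-zero x p))

  constHom : Hom C (Dual K)
  constHom .Hom.⟦_⟧ a      = ⟦ a ⟧ , 0#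
  constHom .Hom.+-homo x y = +-homo x y , sym (+-identityˡ 0#)
  constHom .Hom.*-homo x y = *-homo x y ,
    solve 2 (λ x y → con (ℤ.+ 0) := x :* con (ℤ.+ 0) :+ con (ℤ.+ 0) :* y) refl ⟦ x ⟧ ⟦ y ⟧
  constHom .Hom.-‿homo x   = -‿homo x , sym -0#≈0#
  constHom .Hom.0-homo     = 0-homo , refl
  constHom .Hom.1-homo     = 1-homo , refl

identityHom : ∀ {c ℓ} (K : CommutativeRing c ℓ) → Hom (CommutativeRing.rawRing K) K
identityHom K .Hom.⟦_⟧ x      = x
identityHom K .Hom.+-homo _ _ = CommutativeRing.refl K
identityHom K .Hom.*-homo _ _ = CommutativeRing.refl K
identityHom K .Hom.-‿homo _   = CommutativeRing.refl K
identityHom K .Hom.0-homo     = CommutativeRing.refl K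
identityHom K .Hom.1-homo     = CommutativeRing.refl K

module Taylor {a b c ℓ} {C : RawRing a b} {K : CommutativeRing c ℓ} (h : Hom C K) where
  open CommutativeRing K hiding (zero)
  open IntegerSolver K using (solve; _:=_; _:+_; _:*_; con)
  private
    module H  = Homs h
    module K² = CommutativeRing (Dual K)
    module PU = PolyOps C
    module PTU = PolyOps PU.polyRing

  eval-dual : ∀ x x′ p → Homs.eval H.constHom (x , x′) p K².≈ (H.eval x p , x′ * H.eval x (PU.deriv p))
  eval-dual x x′ []      = refl , sym (zeroʳ x′)
  eval-dual x x′ (a ∷ p) = let s , s′ = eval-dual x x′ p in
    +-congˡ (*-congˡ s) ,
    trans (+-congˡ (+-cong (*-congˡ s′) (*-congˡ s))) (trans
      (solve 4 (λ x x′ e d → con (ℤ.+ 0) :+ (x :* (x′ :* d) :+ x′ :* e) := x′ :* (e :+ x :* d)) refl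
        x x′ (H.eval x p) (H.eval x (PU.deriv p)))
      (*-congˡ (sym (H.eval-deriv-cons x a p))))

  eval₂ : Carrier → Carrier → PTU.Poly → Carrier
  eval₂ u t = Homs.eval (H.evalHom u) t

  -- The target `K` is arbitrary. Taking for it a ring of dual numbers and applying the formula once
  -- more to the derivatives reaches second order.
  eval₂-dual : ∀ u u′ t t′ F → Homs.eval (Homs.evalHom H.constHom (u , u′)) (t , t′) F K².≈
    (eval₂ u t F , t′ * eval₂ u t (PTU.deriv F) + u′ * eval₂ u t (map PU.deriv F))
  eval₂-dual u u′ t t′ []      = refl , solve 2 (λ u t → con (ℤ.+ 0) := t :* con (ℤ.+ 0) :+ u :* con (ℤ.+ 0)) refl u′ t′
  eval₂-dual u u′ t t′ (p ∷ F) = let s , s′ = eval₂-dual u u′ t t′ F ; r , r′ = eval-dual u u′ p in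
    +-cong r (*-congˡ s) ,
    trans (+-cong r′ (+-cong (*-congˡ s′) (*-congˡ s))) (trans
      (solve 7 (λ u′ t t′ p′ e d d′ → u′ :* p′ :+ (t :* (t′ :* d :+ u′ :* d′) :+ t′ :* e)
          := t′ :* (e :+ t :* d) :+ u′ :* (p′ :+ t :* d′)) refl
        u′ t t′ (H.eval u (PU.deriv p)) (eval₂ u t F) (eval₂ u t (PTU.deriv F)) (eval₂ u t (map PU.deriv F)))
      (+-congʳ (*-congˡ (sym (Homs.eval-deriv-cons (H.evalHom u) t p F)))))

-- Images of matrices and determinants under homomorphisms

module MatrixHoms {c ℓ c′ ℓ′} (A : CommutativeRing c ℓ) {B : CommutativeRing c′ ℓ′}
    (h : Hom (CommutativeRing.rawRing A) B) where
  open CommutativeRing B hiding (zero)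
  open Hom h
  open Homs h
  private
    module DA = Determinants A
    module UA = UnitRows A
    module SA = Sums A
    module A = CommutativeRing A
  open Determinants B
  open UnitRows B
  open Sums B

  ∑-homo : ∀ {n} (f : Fin n → A.Carrier) → ⟦ SA.∑ f ⟧ ≈ ∑ (λ i → ⟦ f i ⟧)
  ∑-homo f = trans (reflexive (≡.cong ⟦_⟧ (SA.∑≡sumF f))) (sumF-homo _ f)

  ∑<-homo : ∀ {n} (f : Fin n → Fin n → A.Carrier) → ⟦ UA.∑< f ⟧ ≈ ∑< (λ p q → ⟦ f p q ⟧)
  ∑<-homo f = trans (∑-homo _) (∑-cong λ p → trans (∑-homo _) (∑-cong λ q → cases (toℕ p <ᵇ toℕ q) (f p q)))
    where
    cases : ∀ b x → ⟦ (if b then x else A.0#) ⟧ ≈ (if b then ⟦ x ⟧ else 0#)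
    cases true  x = refl
    cases false x = 0-homo

  det-homo′ : ∀ {n} (M : DA.Matrix n) → ⟦ DA.det M ⟧ ≈ det (λ i j → ⟦ M i j ⟧)
  det-homo′ M = trans (reflexive (≡.cong ⟦_⟧ (DA.det≡ M))) (det-homo M)

  𝟙-homo : ∀ {n} (i j : Fin n) → ⟦ UA.𝟙 i j ⟧ ≈ 𝟙 i j
  𝟙-homo i j = cases (does (i ≟ j))
    where
    cases : ∀ b → ⟦ (if b then A.1# else A.0#) ⟧ ≈ (if b then 1# else 0#)
    cases true  = 1-homo
    cases false = 0-homo

  unitRows-homo : ∀ {n} X (M : DA.Matrix n) {N : Matrix n} → (∀ i j → ⟦ M i j ⟧ ≈ N i j) →
    ∀ i j → ⟦ UA.unitRows X M i j ⟧ ≈ unitRows X N i j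
  unitRows-homo X M eq i j with X i
  ... | true  = 𝟙-homo i j
  ... | false = eq i j

-- Stated for an abstract homomorphism because evaluation computes on the concrete polynomials in fMat.
module FormHomo {a b c ℓ} {C : RawRing a b} {K : CommutativeRing c ℓ} (h : Hom C K) where
  open CommutativeRing K
  open Hom h
  private module C = RawRing C

  form-homo : ∀ D T V S E →
    ⟦ (D C.+ (C.- (T C.* V))) C.+ ((S C.* (T C.* T)) C.* (E C.+ (C.- (S C.* D)))) ⟧ ≈
    (⟦ D ⟧ - ⟦ T ⟧ * ⟦ V ⟧) + (⟦ S ⟧ * (⟦ T ⟧ * ⟦ T ⟧)) * (⟦ E ⟧ - ⟦ S ⟧ * ⟦ D ⟧)
  form-homo D T V S E = trans (+-homo _ _) (+-cong
    (trans (+-homo D _) (+-congˡ (trans (-‿homo _) (-‿cong (*-homo T V)))))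
    (trans (*-homo _ _) (*-cong
      (trans (*-homo S _) (*-congˡ (*-homo T T)))
      (trans (+-homo E _) (+-congˡ (trans (-‿homo _) (-‿cong (*-homo S D))))))))

-- Expansion of the determinant in an algebra where y³ = 0

module Jets {c ℓ c′ ℓ′} (R : CommutativeRing c ℓ) (J : CommutativeRing c′ ℓ′) (ι : Hom (CommutativeRing.rawRing R) J)
    (ι-cong : ∀ {x y} → CommutativeRing._≈_ R x y → CommutativeRing._≈_ J (Hom.⟦ ι ⟧ x) (Hom.⟦ ι ⟧ y)) {m : ℕ}
    (adj : Fin (suc m) → Fin (suc m) → Bool) (w : Fin (suc m) → Fin (suc m) → CommutativeRing.Carrier R)
    (adj-sym : ∀ i j → adj i j ≡ adj j i) (adj-irrefl : ∀ i → adj i i ≡ false)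
    (w-sym : ∀ i j → adj i j ≡ true → CommutativeRing._≈_ R (w i j) (w j i)) where
  open CommutativeRing J hiding (zero)

  -- `y` is a parameter tied to 1 - (1 - u)t by an equation, so that it can be given as a nilpotent
  -- with explicit coordinates.
  module At (u t y : Carrier) (y≈ : y ≈ 1# - (1# - u) * t) (y³≈0 : y * (y * y) ≈ 0#) where

    open Relation.Binary.Reasoning.Setoid setoid
    open IntegerSolver J using (solve; _:=_; _:+_; _:*_; _:-_; :-_; con)
    open Algebra.Properties.Ring ring using (-‿distribˡ-*)
    open RingOps rawRing using (_^_; fromℕ)
    open Determinants J
    open UnitRows J
    open Sums J
    open Hom ι
    private
      module R = CommutativeRing R
      module W = Weighted R adj w
      module G = GraphLaplacian R adj w adj-sym adj-irrefl w-sym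
      module DR = Determinants R
      module UR = UnitRows R

    Φ : Hom W.PTU.polyRing J
    Φ = Homs.evalHom (Homs.evalHom ι u) t

    private module Φ = Hom Φ

    -- The matrix of f_w is tL + diag(y g).
    g : Fin (suc m) → Carrier
    g p = (1# + 1# - y) - t * ⟦ W.dw p ⟧

    tL : Matrix (suc m)
    tL i j = t * ⟦ W.Lap i j ⟧

    cst : R.Carrier → W.BiPoly
    cst x = W.PTU.constP (W.PU.constP x)

    Φ-cst : ∀ x → Φ.⟦ cst x ⟧ ≈ ⟦ x ⟧
    Φ-cst x = trans (Homs.eval-const (Homs.evalHom ι u) t (W.PU.constP x)) (Homs.eval-const ι u x)

    Φ-U : Φ.⟦ W.PTU.constP W.PU.varP ⟧ ≈ u
    Φ-U = trans (Homs.eval-const (Homs.evalHom ι u) t W.PU.varP) (Homs.eval-var ι u)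

    Φ-T : Φ.⟦ W.PTU.varP ⟧ ≈ t
    Φ-T = Homs.eval-var (Homs.evalHom ι u) t

    1-U : W.BiPoly
    1-U = W.PTU.addP (cst R.1#) (W.PTU.negP (W.PTU.constP W.PU.varP))

    Φ-1-U : Φ.⟦ 1-U ⟧ ≈ 1# - u
    Φ-1-U = trans (Φ.+-homo (cst R.1#) (W.PTU.negP (W.PTU.constP W.PU.varP))) (+-cong (trans (Φ-cst R.1#) 1-homo) (trans (Φ.-‿homo (W.PTU.constP W.PU.varP)) (-‿cong Φ-U)))

    ι-Lap : ∀ i j → ⟦ W.Lap i j ⟧ ≈ ⟦ W.δ i j ⟧ * ⟦ W.dw i ⟧ - ⟦ W.Wm i j ⟧
    ι-Lap i j = trans (+-homo _ _) (+-cong (cases (W.eqF i j)) (-‿homo _))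
      where
      cases : ∀ b → ⟦ (if b then W.dw i else R.0#) ⟧ ≈ ⟦ (if b then R.1# else R.0#) ⟧ * ⟦ W.dw i ⟧
      cases true  = sym (trans (*-congʳ 1-homo) (*-identityˡ _))
      cases false = trans 0-homo (sym (trans (*-congʳ 0-homo) (zeroˡ _)))

    Φ-fMat : ∀ i j → Φ.⟦ W.fMat i j ⟧ ≈ tL i j + (y * g i) * 𝟙 i j
    Φ-fMat i j = begin
      Φ.⟦ W.fMat i j ⟧
        ≈⟨ FormHomo.form-homo Φ (cst (W.δ i j)) W.PTU.varP (cst (W.Wm i j)) 1-U (cst (W.δ i j R.* W.dw i)) ⟩
      (Φ.⟦ cst (W.δ i j) ⟧ - Φ.⟦ W.PTU.varP ⟧ * Φ.⟦ cst (W.Wm i j) ⟧)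
        + (Φ.⟦ 1-U ⟧ * (Φ.⟦ W.PTU.varP ⟧ * Φ.⟦ W.PTU.varP ⟧)) * (Φ.⟦ cst (W.δ i j R.* W.dw i) ⟧ - Φ.⟦ 1-U ⟧ * Φ.⟦ cst (W.δ i j) ⟧)
        ≈⟨ +-cong (+-cong (Φ-cst _) (-‿cong (*-cong Φ-T (Φ-cst _))))
             (*-cong (*-cong Φ-1-U (*-cong Φ-T Φ-T))
               (+-cong (trans (Φ-cst _) (*-homo _ _)) (-‿cong (*-cong Φ-1-U (Φ-cst _))))) ⟩
      (D - t * V) + (s * (t * t)) * (D * d - s * D)
        -- With st = 1 - y one has 1 - s²t² = y(2 - y) and st²d = td - y · td. Collecting the
        -- multiples of y gives the diagonal factor `g`.
        ≈⟨ solve 5 (λ D t V s d → (D :- t :* V) :+ (s :* (t :* t)) :* (D :* d :- s :* D)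
             := t :* (D :* d :- V) :+ ((con (ℤ.+ 1) :- s :* t) :* ((con (ℤ.+ 1) :+ con (ℤ.+ 1) :- (con (ℤ.+ 1) :- s :* t)) :- t :* d)) :* D) refl
             D t V s d ⟩
      t * (D * d - V) + ((1# - s * t) * ((1# + 1# - (1# - s * t)) - t * d)) * D
        ≈⟨ +-cong (*-congˡ (ι-Lap i j)) (*-cong (*-cong y≈ (+-congʳ (+-congˡ (-‿cong y≈))))
             (sym (trans (reflexive (≡.cong ⟦_⟧ (G.δ≡𝟙 i j))) (MatrixHoms.𝟙-homo R ι i j)))) ⟨
      tL i j + (y * g i) * 𝟙 i j ∎
      where
      D = ⟦ W.δ i j ⟧
      V = ⟦ W.Wm i j ⟧
      d = ⟦ W.dw i ⟧
      s = 1# - u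

    det-tL : det tL ≈ 0#
    det-tL = trans (det-scale t _) (trans
      (*-congˡ (trans (sym (MatrixHoms.det-homo′ R ι W.Lap)) (trans (ι-cong (G.det-Lap Fin.zero)) 0-homo))) (zeroʳ _))

    det-unitRow-tL : ∀ p → det (unitRow p tL) ≈ t ^ m * ⟦ W.κw ⟧
    det-unitRow-tL p = trans (det-unitRow-scale p t _) (*-congˡ (begin
      det (unitRow p (λ i j → ⟦ W.Lap i j ⟧))
        ≈⟨ det-cong (MatrixHoms.unitRows-homo R ι ⁅ p ⁆ W.Lap (λ i j → refl)) ⟨
      det (λ i j → ⟦ UR.unitRow p W.Lap i j ⟧)
        ≈⟨ MatrixHoms.det-homo′ R ι (UR.unitRow p W.Lap) ⟨
      ⟦ DR.det (UR.unitRow p W.Lap) ⟧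
        ≈⟨ ι-cong (MatrixTree.det-unitRow-Lap R adj w adj-sym adj-irrefl w-sym p) ⟩
      ⟦ W.κw ⟧ ∎))

    ∑-g : ∑ g ≈ ⟦ W.fromℕ (suc m) ⟧ * (1# + 1# - y) - t * ⟦ W.two R.* W.wG ⟧
    ∑-g = begin
      ∑ g
        ≈⟨ ∑-cong (λ p → +-congˡ (-‿distribˡ-* t _)) ⟩
      ∑ (λ p → (1# + 1# - y) + - t * ⟦ W.dw p ⟧)
        ≈⟨ trans (∑-+ _ _) (+-cong (∑-const _ _) (∑-*ˡ _ _)) ⟩
      fromℕ (suc m) * (1# + 1# - y) + - t * ∑ (λ p → ⟦ W.dw p ⟧)
        ≈⟨ +-cong (*-congʳ (sym (Homs.fromℕ-homo ι (suc m))))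
             (*-congˡ (trans (sym (MatrixHoms.∑-homo R ι W.dw)) (ι-cong G.∑-dw))) ⟩
      ⟦ W.fromℕ (suc m) ⟧ * (1# + 1# - y) + - t * ⟦ W.two R.* W.wG ⟧
        ≈⟨ +-congˡ (-‿distribˡ-* t _) ⟨
      ⟦ W.fromℕ (suc m) ⟧ * (1# + 1# - y) - t * ⟦ W.two R.* W.wG ⟧ ∎

    Z : Carrier
    Z = ∑< λ p q → g p * (g q * det (unitRow q (unitRow p tL)))

    -- The coefficient of y: the sum of all `g p` times the common value of the determinants with
    -- one unit row. The arguments stand for w(G) and the weighted complexity.
    X : R.Carrier → R.Carrier → Carrier
    X ω κ = (⟦ W.fromℕ (suc m) ⟧ * (1# + 1# - y) - t * ⟦ W.two R.* ω ⟧) * (t ^ m * ⟦ κ ⟧)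

    -- The equations keep the type checker from computing on fw, wG and κw.
    Φ-fw : ∀ F ω κ → F ≡ W.fw → ω ≡ W.wG → κ ≡ W.κw → Homs.eval (Homs.evalHom ι u) t F ≈ y * X ω κ + (y * y) * Z
    Φ-fw F ω κ F≡fw ≡.refl ≡.refl = begin
      Φ.⟦ F ⟧ ≈⟨ trans (reflexive (≡.cong Φ.⟦_⟧ F≡fw)) (Homs.det-homo Φ W.fMat) ⟩
      det (λ i j → Φ.⟦ W.fMat i j ⟧) ≈⟨ det-cong Φ-fMat ⟩
      det (λ i j → tL i j + (y * g i) * 𝟙 i j) ≈⟨ DiagonalPerturbation.det-diagonal y y³≈0 g tL ⟩
      (det tL + y * ∑ (λ p → g p * det (unitRow p tL))) + (y * y) * Z
        ≈⟨ +-congʳ (trans (+-congʳ det-tL) (+-identityˡ _)) ⟩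
      y * ∑ (λ p → g p * det (unitRow p tL)) + (y * y) * Z
        ≈⟨ +-congʳ (*-congˡ (∑-cong (λ p → trans (*-congˡ (det-unitRow-tL p)) (*-comm _ _)))) ⟩
      y * ∑ (λ p → (t ^ m * ⟦ W.κw ⟧) * g p) + (y * y) * Z
        ≈⟨ +-congʳ (*-congˡ (trans (∑-*ˡ _ _) (trans (*-comm _ _) (*-congʳ ∑-g)))) ⟩
      _ ∎

    -- `β₀`, `D₁`, `D₂`, `D₁₂` stand for the coefficients at 1, ε₁, ε₂, ε₁ε₂. As y has no constant
    -- part, yX needs X only up to first order; y² is 2y₁y₂ε₁ε₂, so of Z only the constant part
    -- matters.
    mixed-coefficient : ∀ (β₀ D₁ D₂ D₁₂ : Carrier → R.Carrier) (y₁ y₂ y₁₂ : R.Carrier) →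
      (∀ {x z} → x ≈ z → D₁₂ x R.≈ D₁₂ z) → (∀ x z → D₁₂ (x + z) R.≈ D₁₂ x R.+ D₁₂ z) →
      (∀ x → D₁₂ (y * x) R.≈ (y₁ R.* D₂ x R.+ y₂ R.* D₁ x) R.+ y₁₂ R.* β₀ x) →
      (∀ x → D₁₂ ((y * y) * x) R.≈ (W.two R.* (y₁ R.* y₂)) R.* β₀ x) →
      ∀ F ω κ → F ≡ W.fw → ω ≡ W.wG → κ ≡ W.κw → ∀ {x₀ x₁ x₂ z₀} →
      β₀ (X ω κ) R.≈ x₀ → D₁ (X ω κ) R.≈ x₁ → D₂ (X ω κ) R.≈ x₂ → β₀ Z R.≈ z₀ →
      D₁₂ (Homs.eval (Homs.evalHom ι u) t F) R.≈
        ((y₁ R.* x₂ R.+ y₂ R.* x₁) R.+ y₁₂ R.* x₀) R.+ (W.two R.* (y₁ R.* y₂)) R.* z₀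
    mixed-coefficient β₀ D₁ D₂ D₁₂ y₁ y₂ y₁₂ cong additive D₁₂-y D₁₂-yy F ω κ F≡ ω≡ κ≡ x₀≈ x₁≈ x₂≈ z₀≈ =
      R.trans (cong (Φ-fw F ω κ F≡ ω≡ κ≡)) (R.trans (additive _ _) (R.+-cong
        (R.trans (D₁₂-y _) (R.+-cong (R.+-cong (R.*-congˡ x₂≈) (R.*-congˡ x₁≈)) (R.*-congˡ x₀≈)))
        (R.trans (D₁₂-yy _) (R.*-congˡ z₀≈))))

    module BasePoint (β : Hom rawRing R) (t₀ : R.Carrier)
        (β-ι : ∀ x → Hom.⟦ β ⟧ ⟦ x ⟧ R.≈ x) (β-t : Hom.⟦ β ⟧ t R.≈ t₀) (β-y : Hom.⟦ β ⟧ y R.≈ R.0#) where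
      open Hom β using () renaming (⟦_⟧ to β⟦_⟧)
      private
        module β = Hom β
        module RR = Relation.Binary.Reasoning.Setoid R.setoid
        module RS = IntegerSolver R

      -- At the base point y is 0, so `g p` becomes the negative of a factor of the Kirchhoff index
      -- function. The signs cancel in the products of two factors in `Z`.
      β-g : ∀ p → β⟦ g p ⟧ R.≈ R.- (W.dw p R.* t₀ R.- W.two)
      β-g p = RR.begin
        β⟦ g p ⟧
          RR.≈⟨ R.trans (β.+-homo _ _) (R.+-cong
                 (R.trans (β.+-homo _ _) (R.+-cong (R.trans (β.+-homo _ _) (R.+-cong β.1-homo β.1-homo))
                   (R.trans (β.-‿homo _) (R.-‿cong β-y))))
                 (R.trans (β.-‿homo _) (R.-‿cong (R.trans (β.*-homo _ _) (R.*-cong β-t (β-ι _)))))) ⟩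
        (R.1# R.+ R.1# R.- R.0#) R.- t₀ R.* W.dw p
          RR.≈⟨ RS.solve 2 (λ t d → (RS.con (ℤ.+ 1) RS.:+ RS.con (ℤ.+ 1) RS.:- RS.con (ℤ.+ 0)) RS.:- t RS.:* d
                 RS.:= RS.:- (d RS.:* t RS.:- (RS.con (ℤ.+ 1) RS.:+ RS.con (ℤ.+ 1)))) R.refl t₀ (W.dw p) ⟩
        R.- (W.dw p R.* t₀ R.- W.two) RR.∎

      β-det : ∀ p q → β⟦ det (unitRow q (unitRow p tL)) ⟧ R.≈
        DR.det (UR.unitRow q (UR.unitRow p (λ i j → t₀ R.* W.Lap i j)))
      β-det p q = R.trans (MatrixHoms.det-homo′ J β _) (DR.det-cong
        (MatrixHoms.unitRows-homo J β ⁅ q ⁆ (unitRow p tL)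
          (MatrixHoms.unitRows-homo J β ⁅ p ⁆ tL (λ i j → R.trans (β.*-homo _ _) (R.*-cong β-t (β-ι _))))))

      β-Z : (t₀ R.* t₀) R.* β⟦ Z ⟧ R.≈ (t₀ W.^ suc m) R.*
        UR.∑< (λ p q → ((W.dw p R.* t₀ R.- W.two) R.* (W.dw q R.* t₀ R.- W.two)) R.* W.detDel2 W.Lap p q)
      β-Z = RR.begin
        (t₀ R.* t₀) R.* β⟦ Z ⟧
          RR.≈⟨ R.*-congˡ (R.trans (MatrixHoms.∑<-homo J β _) (ListSums.∑<-cong R (λ p q _ →
                 R.trans (β.*-homo _ _) (R.*-cong (β-g p) (R.trans (β.*-homo _ _) (R.*-cong (β-g q) (β-det p q))))))) ⟩
        (t₀ R.* t₀) R.* UR.∑< (λ p q → (R.- e p) R.* ((R.- e q) R.* D p q))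
          RR.≈⟨ ListSums.∑<-*ˡ R _ _ ⟨
        UR.∑< (λ p q → (t₀ R.* t₀) R.* ((R.- e p) R.* ((R.- e q) R.* D p q)))
          RR.≈⟨ ListSums.∑<-cong R (λ p q p<q → R.trans
                 (RS.solve 4 (λ t e e′ d → (t RS.:* t) RS.:* ((RS.:- e) RS.:* ((RS.:- e′) RS.:* d))
                   RS.:= (e RS.:* e′) RS.:* ((t RS.:* t) RS.:* d)) R.refl t₀ (e p) (e q) (D p q))
                 (R.trans (R.*-congˡ (UR.det-unitRow₂-scale p q t₀ W.Lap (<ᵇ⇒≢ p q p<q)))
                   (RS.solve 3 (λ e x d → e RS.:* (x RS.:* d) RS.:= x RS.:* (e RS.:* d)) R.refl
                     (e p R.* e q) (t₀ W.^ suc m) (W.detDel2 W.Lap p q)))) ⟩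
        UR.∑< (λ p q → (t₀ W.^ suc m) R.* ((e p R.* e q) R.* W.detDel2 W.Lap p q))
          RR.≈⟨ ListSums.∑<-*ˡ R _ _ ⟩
        _ RR.∎
        where
        e : Fin (suc m) → R.Carrier
        e p = W.dw p R.* t₀ R.- W.two
        D : Fin (suc m) → Fin (suc m) → R.Carrier
        D p q = DR.det (UR.unitRow q (UR.unitRow p (λ i j → t₀ R.* W.Lap i j)))
        <ᵇ⇒≢ : ∀ {n} (p q : Fin n) → (toℕ p <ᵇ toℕ q) ≡ true → p ≢ q
        <ᵇ⇒≢ p q p<q ≡.refl = ℕₚ.<-irrefl ≡.refl (ℕₚ.<ᵇ⇒< (toℕ p) (toℕ p) (from T-≡ p<q))

-- Second derivatives as ε₁ε₂-coefficients

module SecondOrder {c ℓ} (R : CommutativeRing c ℓ) where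
  open CommutativeRing R hiding (zero)
  open RingOps rawRing using (_^_; fromℕ)
  open IntegerSolver R using (solve; _:=_; _:+_; _:*_; con)
  open Relation.Binary.Reasoning.Setoid setoid

  R² : CommutativeRing c ℓ
  R² = Dual R

  private
    module R² = CommutativeRing R²
    module R⁴ = CommutativeRing (Dual R²)
    module Ops⁴ = RingOps R⁴.rawRing
    module PU = PolyOps rawRing
    module PTU = PolyOps PU.polyRing

  -- Coordinates are laid out as ((1, ε₁), (ε₂, ε₁ε₂)): the inner dual numbers carry ε₁ and the
  -- outer ones ε₂.
  ε₁₂ : R⁴.Carrier → Carrier
  ε₁₂ x = proj₂ (proj₂ x)

  const² : Hom rawRing R²
  const² = Homs.constHom (identityHom R)

  const⁴-cong : ∀ {x y} → x ≈ y → Hom.⟦ Homs.constHom const² ⟧ x R⁴.≈ Hom.⟦ Homs.constHom const² ⟧ y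
  const⁴-cong eq = (eq , refl) , (refl , refl)

  base : Hom R⁴.rawRing R
  base = record
    { ⟦_⟧ = proj₁ ∘ proj₁ ; +-homo = λ _ _ → refl ; *-homo = λ _ _ → refl ; -‿homo = λ _ → refl
    ; 0-homo = refl ; 1-homo = refl }

  evalAt : Carrier → Carrier → PTU.Poly → Carrier
  evalAt u t F = PU.eval t (map (PU.eval u) F)

  eval≡ : ∀ x p → Homs.eval (identityHom R) x p ≡ PU.eval x p
  eval≡ x []      = ≡.refl
  eval≡ x (a ∷ p) = ≡.cong (λ z → a + x * z) (eval≡ x p)

  eval₂≡evalAt : ∀ u t F → Taylor.eval₂ (identityHom R) u t F ≡ evalAt u t F
  eval₂≡evalAt u t []      = ≡.refl
  eval₂≡evalAt u t (p ∷ F) = ≡.cong₂ (λ a z → a + t * z) (eval≡ u p) (eval₂≡evalAt u t F)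

  -- The ε₁ε₂-coefficient of F(u + cε₁ + dε₂ , t + aε₁ + bε₂).
  ε₁₂-eval : ∀ u t a b c d F →
    ε₁₂ (Homs.eval (Homs.evalHom (Homs.constHom const²) ((u , c) , (d , 0#))) ((t , a) , (b , 0#)) F) ≈
    b * (a * evalAt u t (PTU.deriv (PTU.deriv F)) + c * evalAt u t (map PU.deriv (PTU.deriv F)))
      + d * (a * evalAt u t (PTU.deriv (map PU.deriv F)) + c * evalAt u t (map PU.deriv (map PU.deriv F)))
  ε₁₂-eval u t a b c d F = begin
    ε₁₂ (Homs.eval (Homs.evalHom (Homs.constHom const²) ((u , c) , (d , 0#))) ((t , a) , (b , 0#)) F)
      -- The Taylor formula is used in the ε₂-direction over `R²`, and below in the ε₁-direction
      -- over `R`. The zeros are the ε₁ε₂-parts of the two coordinates of the point.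
      ≈⟨ proj₂ (proj₂ (Taylor.eval₂-dual const² (u , c) (d , 0#) (t , a) (b , 0#) F)) ⟩
    (b * proj₂ (E₁ (PTU.deriv F)) + 0# * proj₁ (E₁ (PTU.deriv F)))
      + (d * proj₂ (E₁ (map PU.deriv F)) + 0# * proj₁ (E₁ (map PU.deriv F)))
      ≈⟨ +-cong (drop b _ _) (drop d _ _) ⟩
    b * proj₂ (E₁ (PTU.deriv F)) + d * proj₂ (E₁ (map PU.deriv F))
      ≈⟨ +-cong (*-congˡ (E₁₂ (PTU.deriv F))) (*-congˡ (E₁₂ (map PU.deriv F))) ⟩
    _ ∎
    where
    E₁ : PTU.Poly → R².Carrier
    E₁ = Taylor.eval₂ const² (u , c) (t , a)

    drop : ∀ x y z → x * y + 0# * z ≈ x * y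
    drop x y z = trans (+-congˡ (zeroˡ z)) (+-identityʳ _)

    E₁₂ : ∀ G → proj₂ (E₁ G) ≈ a * evalAt u t (PTU.deriv G) + c * evalAt u t (map PU.deriv G)
    E₁₂ G = trans (proj₂ (Taylor.eval₂-dual (identityHom R) u c t a G))
      (+-cong (*-congˡ (reflexive (eval₂≡evalAt u t (PTU.deriv G)))) (*-congˡ (reflexive (eval₂≡evalAt u t (map PU.deriv G)))))

  -- This is m t^(m-1), built by the product rule so that no exponent is lowered.
  powerDerivative : Carrier → ℕ → Carrier
  powerDerivative t zero    = 0#
  powerDerivative t (suc m) = t ^ m + t * powerDerivative t m

  t*powerDerivative : ∀ t m → t * powerDerivative t m ≈ fromℕ m * t ^ m
  t*powerDerivative t zero    = trans (zeroʳ t) (sym (zeroˡ _))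
  t*powerDerivative t (suc m) = trans (distribˡ t _ _) (trans (+-congˡ (*-congˡ (t*powerDerivative t m)))
    (solve 3 (λ t k x → t :* x :+ t :* (k :* x) := (con (ℤ.+ 1) :+ k) :* (t :* x)) refl t (fromℕ m) (t ^ m)))

  power-base : ∀ t a b m → proj₁ (proj₁ (((t , a) , (b , 0#)) Ops⁴.^ m)) ≈ t ^ m
  power-base t a b zero    = refl
  power-base t a b (suc m) = *-congˡ (power-base t a b m)

  power-ε₁ : ∀ t a b m → proj₂ (proj₁ (((t , a) , (b , 0#)) Ops⁴.^ m)) ≈ a * powerDerivative t m
  power-ε₁ t a b zero    = sym (zeroʳ a)
  power-ε₁ t a b (suc m) = trans (+-cong (*-congˡ (power-ε₁ t a b m)) (*-congˡ (power-base t a b m)))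
    (solve 4 (λ t a x d → t :* (a :* d) :+ a :* x := a :* (x :+ t :* d)) refl t a (t ^ m) (powerDerivative t m))

  power-ε₂ : ∀ t a b m → proj₁ (proj₂ (((t , a) , (b , 0#)) Ops⁴.^ m)) ≈ b * powerDerivative t m
  power-ε₂ t a b zero    = sym (zeroʳ b)
  power-ε₂ t a b (suc m) = trans (+-cong (*-congˡ (power-ε₂ t a b m)) (*-congˡ (power-base t a b m)))
    (solve 4 (λ t a x d → t :* (a :* d) :+ a :* x := a :* (x :+ t :* d)) refl t b (t ^ m) (powerDerivative t m))

  nilpotent : Carrier → Carrier → Carrier → R⁴.Carrier
  nilpotent y₁ y₂ y₁₂ = (0# , y₁) , (y₂ , y₁₂)

  private
    :0 :1 : ∀ {k} → IntegerSolver.Polynomial R k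
    :0 = con (ℤ.+ 0)
    :1 = con (ℤ.+ 1)

  ε₁₂-nilpotent : ∀ y₁ y₂ y₁₂ x → ε₁₂ (nilpotent y₁ y₂ y₁₂ R⁴.* x) ≈
    (y₁ * proj₁ (proj₂ x) + y₂ * proj₂ (proj₁ x)) + y₁₂ * proj₁ (proj₁ x)
  ε₁₂-nilpotent y₁ y₂ y₁₂ ((x₀ , x₁) , (x₂ , x₃)) =
    solve 7 (λ y₁ y₂ y₃ x₀ x₁ x₂ x₃ → (:0 :* x₃ :+ y₁ :* x₂) :+ (y₂ :* x₁ :+ y₃ :* x₀)
      := (y₁ :* x₂ :+ y₂ :* x₁) :+ y₃ :* x₀) refl y₁ y₂ y₁₂ x₀ x₁ x₂ x₃

  nilpotent² : ∀ y₁ y₂ y₁₂ → nilpotent y₁ y₂ y₁₂ R⁴.* nilpotent y₁ y₂ y₁₂ R⁴.≈ nilpotent 0# 0# ((1# + 1#) * (y₁ * y₂))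
  nilpotent² y₁ y₂ y₁₂ =
    (zeroˡ 0# , solve 1 (λ x → :0 :* x :+ x :* :0 := :0) refl y₁) ,
    (solve 1 (λ x → :0 :* x :+ x :* :0 := :0) refl y₂ ,
     solve 3 (λ y₁ y₂ y₃ → (:0 :* y₃ :+ y₁ :* y₂) :+ (y₂ :* y₁ :+ y₃ :* :0) := (:1 :+ :1) :* (y₁ :* y₂)) refl y₁ y₂ y₁₂)

  nilpotent³ : ∀ y₁ y₂ y₁₂ → let y = nilpotent y₁ y₂ y₁₂ in y R⁴.* (y R⁴.* y) R⁴.≈ R⁴.0#
  nilpotent³ y₁ y₂ y₁₂ = R⁴.trans (R⁴.*-congˡ {nilpotent y₁ y₂ y₁₂} (nilpotent² y₁ y₂ y₁₂))
    ((zeroˡ 0# , solve 1 (λ x → :0 :* :0 :+ x :* :0 := :0) refl y₁) ,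
    (solve 1 (λ x → :0 :* :0 :+ x :* :0 := :0) refl y₂ ,
     solve 4 (λ y₁ y₂ y₃ z → (:0 :* z :+ y₁ :* :0) :+ (y₂ :* :0 :+ y₃ :* :0) := :0) refl y₁ y₂ y₁₂ ((1# + 1#) * (y₁ * y₂))))

  ε₁₂-nilpotent² : ∀ y₁ y₂ y₁₂ x → let y = nilpotent y₁ y₂ y₁₂ in
    ε₁₂ ((y R⁴.* y) R⁴.* x) ≈ ((1# + 1#) * (y₁ * y₂)) * proj₁ (proj₁ x)
  ε₁₂-nilpotent² y₁ y₂ y₁₂ x = trans (proj₂ (proj₂ (R⁴.*-congʳ {x} (nilpotent² y₁ y₂ y₁₂))))
    (trans (ε₁₂-nilpotent 0# 0# ((1# + 1#) * (y₁ * y₂)) x)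
      (trans (+-congʳ (trans (+-cong (zeroˡ _) (zeroˡ _)) (+-identityˡ 0#))) (+-identityˡ _)))

-- The Hessian of the determinant at u = 1 - 1/t

module Hessian {c ℓ} (R : CommutativeRing c ℓ) {m : ℕ}
    (adj : Fin (suc m) → Fin (suc m) → Bool) (w : Fin (suc m) → Fin (suc m) → CommutativeRing.Carrier R)
    (adj-sym : ∀ i j → adj i j ≡ adj j i) (adj-irrefl : ∀ i → adj i i ≡ false)
    (w-sym : ∀ i j → adj i j ≡ true → CommutativeRing._≈_ R (w i j) (w j i)) where
  open CommutativeRing R hiding (zero)
  open Weighted R adj w

  module At (t ti κi : Carrier) (t*ti≈1 : t * ti ≈ 1#)
      (F : BiPoly) (κ ω K : Carrier) (κ*κi≈1 : κ * κi ≈ 1#) (F≡fw : F ≡ fw) (κ≡κw : κ ≡ κw)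
      (ω≡wG : ω ≡ wG) (K≡Kfz : K ≡ Kfz κi t) where

    open Relation.Binary.Reasoning.Setoid setoid
    open IntegerSolver R using (solve; Polynomial; _:=_; _:+_; _:*_; _:-_; :-_; con)
    open SecondOrder R using (R²; const²; const⁴-cong; base; ε₁₂; ε₁₂-eval; ε₁₂-nilpotent; ε₁₂-nilpotent²;
      nilpotent; nilpotent³; powerDerivative; t*powerDerivative; power-base; power-ε₁; power-ε₂)
    open Sums R using (∑≡sumF; ∑-cong)
    open UnitRows R using (∑<)
    open ListSums R using (∑<-cong; ∑<-*ˡ)
    private
      module R⁴ = CommutativeRing (Dual R²)
      :0 :1 : ∀ {k} → Polynomial k
      :0 = con (ℤ.+ 0)
      :1 = con (ℤ.+ 1)

    u₀ tᵐ q : Carrier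
    u₀ = 1# - ti
    tᵐ = t ^ m
    q  = powerDerivative t m

    Kfz≈∑< : ∀ K → K ≡ Kfz κi t → K ≈ ∑< (λ p q → ((dw p * t - two) * (dw q * t - two)) * (detDel2 Lap p q * κi))
    Kfz≈∑< _ ≡.refl = sym (trans (∑-cong (λ p → reflexive (∑≡sumF _))) (reflexive (∑≡sumF _)))

    κ*Kfz : κ * K ≈ ∑< (λ p q → ((dw p * t - two) * (dw q * t - two)) * detDel2 Lap p q)
    κ*Kfz = begin
      κ * K
        ≈⟨ *-congˡ (Kfz≈∑< K K≡Kfz) ⟩
      κ * ∑< (λ p q → ((dw p * t - two) * (dw q * t - two)) * (detDel2 Lap p q * κi))
        ≈⟨ ∑<-*ˡ κ _ ⟨
      ∑< (λ p q → κ * (((dw p * t - two) * (dw q * t - two)) * (detDel2 Lap p q * κi)))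
        ≈⟨ ∑<-cong (λ p q _ → trans
             (regroup κ ((dw p * t - two) * (dw q * t - two)) (detDel2 Lap p q) κi)
             (trans (*-congʳ κ*κi≈1) (*-identityˡ _))) ⟩
      ∑< (λ p q → ((dw p * t - two) * (dw q * t - two)) * detDel2 Lap p q) ∎
      where
      regroup : ∀ k e d k′ → k * (e * (d * k′)) ≈ (k * k′) * (e * d)
      regroup = solve 4 (λ k e d k′ → k :* (e :* (d :* k′)) := (k :* k′) :* (e :* d)) refl

    q≈ : q ≈ ti * (fromℕ m * tᵐ)
    q≈ = begin
      q            ≈⟨ *-identityˡ q ⟨
      1# * q       ≈⟨ *-congʳ t*ti≈1 ⟨
      (t * ti) * q ≈⟨ solve 3 (λ t t′ q → (t :* t′) :* q := t′ :* (t :* q)) refl t ti q ⟩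
      ti * (t * q) ≈⟨ *-congˡ (t*powerDerivative t m) ⟩
      ti * (fromℕ m * tᵐ) ∎

    -- ε₁ moves (t, u) by (a, c) and ε₂ by (b, d); coordinate directions will single out the three
    -- second derivatives.
    module Direction (a b c d : Carrier) where

      ũ t̃ y : R⁴.Carrier
      ũ = (u₀ , c) , (d , 0#)
      t̃ = (t , a) , (b , 0#)

      y₁ y₂ y₁₂ : Carrier
      -- At u = 1 - 1/t the function 1 - (1 - u)t has u-derivative t, t-derivative -1/t and mixed
      -- derivative 1.
      y₁  = c * t - a * ti
      y₂  = d * t - b * ti
      y₁₂ = c * b + d * a
      y = nilpotent y₁ y₂ y₁₂

      y≈ : y R⁴.≈ R⁴.1# R⁴.- (R⁴.1# R⁴.- ũ) R⁴.* t̃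
      y≈ = (sym (trans (solve 2 (λ t t′ → :1 :- (:1 :- (:1 :- t′)) :* t := :1 :- t :* t′) refl t ti)
                 (trans (+-congˡ (-‿cong t*ti≈1)) (-‿inverseʳ 1#)))
           , linear t ti a c)
         , (linear t ti b d
           , solve 6 (λ t t′ a b c d → c :* b :+ d :* a :=
               :0 :- (((:1 :- (:1 :- t′)) :* :0 :+ (:0 :- c) :* b) :+ ((:0 :- d) :* a :+ (:0 :- :0) :* t))) refl t ti a b c d)
        where
        linear : ∀ t ti a c → c * t - a * ti ≈ 0# - ((1# - (1# - ti)) * a + (0# - c) * t)
        linear = solve 4 (λ t t′ a c → c :* t :- a :* t′ := :0 :- ((:1 :- (:1 :- t′)) :* a :+ (:0 :- c) :* t)) refl

      Z : R⁴.Carrier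
      Z = Jets.At.Z R (Dual R²) (Homs.constHom const²) const⁴-cong adj w adj-sym adj-irrefl w-sym ũ t̃ y y≈ (nilpotent³ y₁ y₂ y₁₂)

      Z₀ : Carrier
      Z₀ = proj₁ (proj₁ Z)

      Z₀≈ : Z₀ ≈ (ti * ti) * ((t * tᵐ) * (κ * K))
      Z₀≈ = begin
        Z₀ ≈⟨ trans (*-congʳ (*-identityˡ 1#)) (*-identityˡ Z₀) ⟨
        (1# * 1#) * Z₀ ≈⟨ *-congʳ (*-cong t*ti≈1 t*ti≈1) ⟨
        ((t * ti) * (t * ti)) * Z₀
          ≈⟨ solve 3 (λ t t′ z → ((t :* t′) :* (t :* t′)) :* z := (t′ :* t′) :* ((t :* t) :* z)) refl t ti Z₀ ⟩
        (ti * ti) * ((t * t) * Z₀)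
          ≈⟨ *-congˡ (Jets.At.BasePoint.β-Z R (Dual R²) (Homs.constHom const²) const⁴-cong adj w adj-sym adj-irrefl w-sym
               ũ t̃ y y≈ (nilpotent³ y₁ y₂ y₁₂) base t (λ _ → refl) refl refl) ⟩
        (ti * ti) * ((t * tᵐ) * ∑< (λ p q → ((dw p * t - two) * (dw q * t - two)) * detDel2 Lap p q))
          ≈⟨ *-congˡ (*-congˡ κ*Kfz) ⟨
        (ti * ti) * ((t * tᵐ) * (κ * K)) ∎

      private
        n W : Carrier
        n = fromℕ (suc m)
        W = two * ω

        P X : R⁴.Carrier
        P = RingOps._^_ R⁴.rawRing t̃ m
        X = Jets.At.X R (Dual R²) (Homs.constHom const²) const⁴-cong adj w adj-sym adj-irrefl w-sym ũ t̃ y y≈ (nilpotent³ y₁ y₂ y₁₂) ω κ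

        P₀ P₁ P₂ : Carrier
        P₀ = proj₁ (proj₁ P)
        P₁ = proj₂ (proj₁ P)
        P₂ = proj₁ (proj₂ P)

      X-base : proj₁ (proj₁ X) ≈ (n * two - t * W) * (tᵐ * κ)
      X-base = *-cong (solve 3 (λ n t W → n :* (:1 :+ :1 :- :0) :- t :* W := n :* (:1 :+ :1) :- t :* W) refl n t W)
        (*-congʳ (power-base t a b m))

      ε-part : ∀ n t W κ y a P₀ P₁ → (n * (1# + 1# - 0#) - t * W) * (P₀ * 0# + P₁ * κ)
          + ((n * (0# + 0# - y) + 0# * (1# + 1# - 0#)) - (t * 0# + a * W)) * (P₀ * κ) ≈
        ((n * (1# + 1#) - t * W) * P₁ - (n * y + a * W) * P₀) * κ
      ε-part = solve 8 (λ n t W κ y a P₀ P₁ → (n :* (:1 :+ :1 :- :0) :- t :* W) :* (P₀ :* :0 :+ P₁ :* κ)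
          :+ ((n :* (:0 :+ :0 :- y) :+ :0 :* (:1 :+ :1 :- :0)) :- (t :* :0 :+ a :* W)) :* (P₀ :* κ) :=
        ((n :* (:1 :+ :1) :- t :* W) :* P₁ :- (n :* y :+ a :* W) :* P₀) :* κ) refl

      X-ε₁ : proj₂ (proj₁ X) ≈ ((n * two - t * W) * (a * q) - (n * y₁ + a * W) * tᵐ) * κ
      X-ε₁ = trans (ε-part n t W κ y₁ a P₀ P₁)
        (*-congʳ (+-cong (*-congˡ (power-ε₁ t a b m)) (-‿cong (*-congˡ (power-base t a b m)))))

      X-ε₂ : proj₁ (proj₂ X) ≈ ((n * two - t * W) * (b * q) - (n * y₂ + b * W) * tᵐ) * κ
      X-ε₂ = trans (ε-part n t W κ y₂ b P₀ P₂)
        (*-congʳ (+-cong (*-congˡ (power-ε₂ t a b m)) (-‿cong (*-congˡ (power-base t a b m)))))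

      -- The left side is the Hessian as a bilinear form in (a, c) and (b, d). On the right, m
      -- t^(m-1) is written as `ti` times m t^m, so that a single power of t remains for the solver.
      second-order : b * (a * evalAt u₀ t (∂t (∂t F)) + c * evalAt u₀ t (∂u (∂t F)))
          + d * (a * evalAt u₀ t (∂t (∂u F)) + c * evalAt u₀ t (∂u (∂u F))) ≈
        ((y₁ * (((n * two - t * W) * (b * (ti * (fromℕ m * tᵐ))) - (n * y₂ + b * W) * tᵐ) * κ)
          + y₂ * (((n * two - t * W) * (a * (ti * (fromℕ m * tᵐ))) - (n * y₁ + a * W) * tᵐ) * κ))
          + y₁₂ * ((n * two - t * W) * (tᵐ * κ)))
        + (two * (y₁ * y₂)) * ((ti * ti) * ((t * tᵐ) * (κ * K)))
      second-order = trans (sym (ε₁₂-eval u₀ t a b c d F))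
        (Jets.At.mixed-coefficient R (Dual R²) (Homs.constHom const²) const⁴-cong adj w adj-sym adj-irrefl w-sym
          ũ t̃ y y≈ (nilpotent³ y₁ y₂ y₁₂)
          (λ x → proj₁ (proj₁ x)) (λ x → proj₂ (proj₁ x)) (λ x → proj₁ (proj₂ x)) ε₁₂ y₁ y₂ y₁₂
          (λ eq → proj₂ (proj₂ eq)) (λ _ _ → refl) (ε₁₂-nilpotent y₁ y₂ y₁₂) (ε₁₂-nilpotent² y₁ y₂ y₁₂)
          F ω κ F≡fw ω≡wG κ≡κw
          X-base
          (trans X-ε₁ (*-congʳ (+-congʳ (*-congˡ (*-congˡ q≈)))))
          (trans X-ε₂ (*-congʳ (+-congʳ (*-congˡ (*-congˡ q≈)))))
          Z₀≈)

    private
      n = fromℕ (suc m)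
      :2 :4 : ∀ {k} → Polynomial k
      :2 = :1 :+ :1
      :4 = con (ℤ.+ 4)

      -- The multiplier C in the final identities  left = right + (t ti − 1) C  is the quotient of polynomial
      -- division by t ti − 1.
      cancel : ∀ {x y} C → x ≈ y + (t * ti - 1#) * C → x ≈ y
      cancel {x} {y} C eq = begin
        x                      ≈⟨ eq ⟩
        y + (t * ti - 1#) * C  ≈⟨ +-congˡ (*-congʳ (trans (+-congʳ t*ti≈1) (-‿inverseʳ 1#))) ⟩
        y + 0# * C             ≈⟨ trans (+-congˡ (zeroˡ C)) (+-identityʳ y) ⟩
        y ∎

    form : ∀ {k} (a b c d t ti tᵐ M w κ K : Polynomial k) → Polynomial k
    form a b c d t ti tᵐ M w κ K =
        ((y₁ :* (((n′ :* :2 :- t :* W) :* (b :* (ti :* (M :* tᵐ))) :- (n′ :* y₂ :+ b :* W) :* tᵐ) :* κ)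
          :+ y₂ :* (((n′ :* :2 :- t :* W) :* (a :* (ti :* (M :* tᵐ))) :- (n′ :* y₁ :+ a :* W) :* tᵐ) :* κ))
          :+ (c :* b :+ d :* a) :* ((n′ :* :2 :- t :* W) :* (tᵐ :* κ)))
        :+ (:2 :* (y₁ :* y₂)) :* ((ti :* ti) :* ((t :* tᵐ) :* (κ :* K)))
      where
      y₁ = c :* t :- a :* ti
      y₂ = d :* t :- b :* ti
      n′ = :1 :+ M
      W  = :2 :* w

    ∂tt : evalAt u₀ t (∂t (∂t F)) ≈ two * (t ^ suc m * ti ^ 4) * κ * (K + n * t * (two * ω * t - two * n + 1#))
    ∂tt = cancel _ (begin
      evalAt u₀ t (∂t (∂t F)) ≈⟨ pick _ _ _ _ ⟩
      _ ≈⟨ Direction.second-order 1# 1# 0# 0# ⟩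
      _ ≈⟨ solve 7 (λ t ti tᵐ M w κ K → let n = :1 :+ M in form :1 :1 :0 :0 t ti tᵐ M w κ K :=
             :2 :* ((t :* tᵐ) :* (ti :* (ti :* (ti :* (ti :* :1))))) :* κ :* (K :+ n :* t :* (:2 :* w :* t :- :2 :* n :+ :1))
             :+ (t :* ti :- :1) :* ((tᵐ :* κ :* ti) :*
               ((t :* ti :+ :1) :* (n :* (:4 :* n :- :2) :* ti :- :4 :* n :* w :* t :* ti) :- :4 :* w))) refl
             t ti tᵐ (fromℕ m) ω κ K ⟩
      _ ∎)
      where
      pick : ∀ x x′ x″ z → z ≈ 1# * (1# * z + 0# * x) + 0# * (1# * x′ + 0# * x″)
      pick = solve 4 (λ x x′ x″ z → z := :1 :* (:1 :* z :+ :0 :* x) :+ :0 :* (:1 :* x′ :+ :0 :* x″)) refl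

    ∂tu : evalAt u₀ t (∂t (∂u F)) ≈ two * (t ^ suc m * ti ^ 2) * κ * ((n - ω * t) * (n + 1#) * t - K)
    ∂tu = cancel _ (begin
      evalAt u₀ t (∂t (∂u F)) ≈⟨ pick _ _ _ _ ⟩
      -- ε₁ points along t and ε₂ along u, so only the mixed derivative survives.
      _ ≈⟨ Direction.second-order 1# 0# 0# 1# ⟩
      _ ≈⟨ solve 7 (λ t ti tᵐ M w κ K → let n = :1 :+ M in form :1 :0 :0 :1 t ti tᵐ M w κ K :=
             :2 :* ((t :* tᵐ) :* (ti :* (ti :* :1))) :* κ :* ((n :- w :* t) :* (n :+ :1) :* t :- K)
             :+ (t :* ti :- :1) :* ((tᵐ :* κ) :*
               (:2 :* (n :+ :1) :* w :* t :* t :* ti :- :2 :* n :* (n :+ :1) :* t :* ti :+ :4 :* w :* t :- :2 :* n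
                 :- :2 :* K :* t :* ti :* ti))) refl
             t ti tᵐ (fromℕ m) ω κ K ⟩
      _ ∎)
      where
      pick : ∀ x x′ x″ z → z ≈ 0# * (1# * x + 0# * x′) + 1# * (1# * z + 0# * x″)
      pick = solve 4 (λ x x′ x″ z → z := :0 :* (:1 :* x :+ :0 :* x′) :+ :1 :* (:1 :* z :+ :0 :* x″)) refl

    ∂uu : evalAt u₀ t (∂u (∂u F)) ≈ two * t ^ suc m * κ * (K - n * t)
    ∂uu = cancel _ (begin
      evalAt u₀ t (∂u (∂u F)) ≈⟨ pick _ _ _ _ ⟩
      _ ≈⟨ Direction.second-order 0# 0# 1# 1# ⟩
      _ ≈⟨ solve 7 (λ t ti tᵐ M w κ K → form :0 :0 :1 :1 t ti tᵐ M w κ K :=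
             :2 :* (t :* tᵐ) :* κ :* (K :- (:1 :+ M) :* t)
             :+ (t :* ti :- :1) :* ((:2 :* tᵐ :* κ :* K :* t) :* (t :* ti :+ :1))) refl t ti tᵐ (fromℕ m) ω κ K ⟩
      _ ∎)
      where
      pick : ∀ x x′ x″ z → z ≈ 0# * (0# * x + 1# * x′) + 1# * (0# * x″ + 1# * z)
      pick = solve 4 (λ x x′ x″ z → z := :0 :* (:0 :* x :+ :1 :* x′) :+ :1 :* (:0 :* x″ :+ :1 :* z)) refl

theorem12 : ∀ {c ℓ} (R : CommutativeRing c ℓ) (F : FieldStr R) (n : ℕ)
    (adj : Fin n → Fin n → Bool) (w : Fin n → Fin n → CommutativeRing.Carrier R) →
    let open CommutativeRing R
        open Weighted R adj w
        open FieldStr F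
    in (∀ i j → adj i j ≡ adj j i) →
       (∀ i → adj i i ≡ false) →
       Connected adj →
       (∀ i j → adj i j ≡ true → w i j ≈ w j i) →
       (κnz : ¬ (κw ≈ 0#)) →
       (t : Carrier) (tnz : ¬ (t ≈ 0#)) →
       let κi = inv κw κnz
           ti = inv t tnz
           u₀ = 1# - ti
           nR = fromℕ n
           K  = Kfz κi t
       in (evalAt u₀ t (∂t (∂t fw))
             ≈ two * (t ^ n * ti ^ 4) * κw * (K + nR * t * (two * wG * t - two * nR + 1#)))
          × (evalAt u₀ t (∂t (∂u fw))
             ≈ two * (t ^ n * ti ^ 2) * κw * ((nR - wG * t) * (nR + 1#) * t - K))
          × (evalAt u₀ t (∂u (∂u fw))
             ≈ two * t ^ n * κw * (K - nR * t))
-- Without vertices `fw` is the constant 1, and n, w(G) and the Kirchhoff sum are 0, so both sides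
-- vanish. The third left side computes to 0 + t · 0 because `∂u` keeps one, now empty, coefficient.
theorem12 R F zero adj w adj-sym adj-irrefl conn w-sym κnz t tnz =
    solve 2 (λ x t → :0 := x :* (:0 :+ :0 :* t :* ((:1 :+ :1) :* :0 :* t :- (:1 :+ :1) :* :0 :+ :1))) refl _ t
  , solve 2 (λ x t → :0 := x :* ((:0 :- :0 :* t) :* (:0 :+ :1) :* t :- :0)) refl _ t
  , solve 2 (λ x t → :0 :+ t :* :0 := x :* (:0 :- :0 :* t)) refl _ t
  where
  open CommutativeRing R hiding (zero)
  open IntegerSolver R using (solve; Polynomial; _:=_; _:+_; _:*_; _:-_; con)
  :0 :1 : ∀ {k} → Polynomial k
  :0 = con (ℤ.+ 0)
  :1 = con (ℤ.+ 1)
theorem12 R F (suc m) adj w adj-sym adj-irrefl conn w-sym κnz t tnz = H.∂tt , H.∂tu , H.∂uu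
  where
  open FieldStr F
  open Weighted R adj w
  module H = Hessian.At R adj w adj-sym adj-irrefl w-sym t (inv t tnz) (inv κw κnz) (inv-r t tnz)
    fw κw wG (Kfz (inv κw κnz) t) (inv-r κw κnz) ≡.refl ≡.refl ≡.refl ≡.refl
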